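{- Every $n$-vertex triangulation on a non-orientable surface has a non-contractible cycle of length at most $2\sqrt{n}$.
   Context: A triangulation on a surface is a finite simple graph embedded on the (compact, boundaryless) surface such that every face is bounded by a triangle. A cycle of the embedded graph is non-contractible if, viewed as a closed curve on the surface, it is not contractible to a point. -}

module Defs where

open import Data.Nat using (ℕ; _*_; _≤_)
open import Data.Fin using (Fin)
open import Data.Product using (Σ; ∃; ∃-syntax; _×_; _,_)
open import Data.Sum using (_⊎_)
open import Data.Bool using (Bool; true; false)
open import Data.List using (List; []; _∷_; _++_; length)
open import Data.List.Relation.Unary.Linked using (Linked)
open import Data.List.Relation.Unary.Unique.Propositional using (Unique)
open import Relation.Binary.Construct.Closure.ReflexiveTransitive using (Star)
open import Relation.Binary.Construct.Closure.Equivalence using (EqClosure)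
open import Relation.Binary.PropositionalEquality using (_≡_; _≢_)
open import Relation.Nullary using (¬_)

-- Abstract 2-complexes on the vertex set Fin n with m triangular faces.
-- A face is given by its three corners.

Tri : ℕ → Set
Tri n = Fin n × Fin n × Fin n

module _ {n m : ℕ} (face : Fin m → Tri n) where

  _∈F_ : Fin n → Fin m → Set
  v ∈F i with face i
  ... | (a , b , c) = v ≡ a ⊎ v ≡ b ⊎ v ≡ c

  ProperFace : Fin m → Set
  ProperFace i with face i
  ... | (a , b , c) = a ≢ b × b ≢ c × a ≢ c

  SameVertexSet : Fin m → Fin m → Set
  SameVertexSet i j = ∀ v → (v ∈F i → v ∈F j) × (v ∈F j → v ∈F i)

  Adj : Fin n → Fin n → Set
  Adj u v = u ≢ v × ∃[ i ] (u ∈F i × v ∈F i)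

  EdgeOnTwoFaces : Set
  EdgeOnTwoFaces = ∀ u v → Adj u v →
    ∃[ i ] ∃[ j ] (i ≢ j × (u ∈F i × v ∈F i) × (u ∈F j × v ∈F j) ×
      (∀ k → u ∈F k → v ∈F k → k ≡ i ⊎ k ≡ j))

  LinkAdj : Fin n → Fin m → Fin m → Set
  LinkAdj v i j = v ∈F i × v ∈F j × ∃[ u ] (u ≢ v × u ∈F i × u ∈F j)

  -- the faces around every vertex form a single cycle (disk neighbourhood)
  LinkConnected : Set
  LinkConnected = ∀ v i j → v ∈F i → v ∈F j → Star (LinkAdj v) i j

  DirEdge : Bool → Fin m → Fin n → Fin n → Set
  DirEdge true i x y with face i
  ... | (a , b , c) = (x ≡ a × y ≡ b) ⊎ (x ≡ b × y ≡ c) ⊎ (x ≡ c × y ≡ a)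
  DirEdge false i x y with face i
  ... | (a , b , c) = (x ≡ b × y ≡ a) ⊎ (x ≡ c × y ≡ b) ⊎ (x ≡ a × y ≡ c)

  CoherentOrientation : (Fin m → Bool) → Set
  CoherentOrientation o =
    ∀ i j x y → DirEdge (o i) i x y → DirEdge (o j) j x y → i ≡ j

  Orientable : Set
  Orientable = ∃[ o ] CoherentOrientation o

  -- Homotopy of closed walks (edge-path group of the 2-complex).
  -- A walk is a list of vertices; elementary moves: cancel a backtrack
  -- u v u ↦ u, and push across a face u w ↦ u v w for a face {u,v,w}.

  data HStep : List (Fin n) → List (Fin n) → Set where
    backtrack : ∀ p q u v → Adj u v →
      HStep (p ++ u ∷ v ∷ u ∷ q) (p ++ u ∷ q)
    across : ∀ p q u v w i → u ∈F i → v ∈F i → w ∈F i →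
      u ≢ v → v ≢ w → u ≢ w →
      HStep (p ++ u ∷ w ∷ q) (p ++ u ∷ v ∷ w ∷ q)

  -- a closed walk based at v (listed as v … v) is contractible iff it is
  -- homotopic (rel. base point) to the constant walk at v
  ContractibleClosedWalk : Fin n → List (Fin n) → Set
  ContractibleClosedWalk v w = EqClosure HStep w (v ∷ [])

  IsCycle : Fin n → List (Fin n) → Set
  IsCycle v rest =
    Unique (v ∷ rest) × 3 ≤ length (v ∷ rest) × Linked Adj (v ∷ rest ++ v ∷ [])

record Triangulation (n : ℕ) : Set where
  field
    m            : ℕ
    face         : Fin m → Tri n
    proper       : ∀ i → ProperFace face i
    distinct     : ∀ i j → SameVertexSet face i j → i ≡ j
    covered      : ∀ v → ∃[ i ] (_∈F_ face v i)
    connected    : ∀ u v → Star (Adj face) u v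
    edgeTwo      : EdgeOnTwoFaces face
    linkConn     : LinkConnected face

NonOrientable : ∀ {n} → Triangulation n → Set
NonOrientable T = ¬ Orientable (Triangulation.face T)

HasNonContractibleCycleOfLength : ∀ {n} → Triangulation n → ℕ → Set
HasNonContractibleCycleOfLength T k =
  ∃[ v ] ∃[ rest ] (IsCycle (Triangulation.face T) v rest ×
    length (v ∷ rest) ≡ k ×
    ¬ ContractibleClosedWalk (Triangulation.face T) v (v ∷ rest ++ v ∷ []))

{-# OPTIONS --safe #-}

-- Work with mod 2 chains and call a closed walk bounding if it is the boundary of a set of faces; contractible closed
-- walks bound, and boundingness is decidable. The edges across which the orientations of two faces disagree form a
-- cycle that bounds only if the surface is orientable, so there is a shortest non-bounding closed walk C, of length
-- k = 2s + η with η ≤ 1. Let B_r be the ball of radius r < s around a vertex (η = 0) or an edge (η = 1) of C. Cycles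
-- inside B_r bound, being sums of closed walks shorter than k, and C leaves B_r at two vertices x, y of the sphere
-- L_r. If x and y lay in different components of L_r, the component of x would be two-sided and its boundary curve
-- would bound a set of faces, yet C would cross it exactly once. So x and y are joined by an arc in L_r, and replacing
-- the part of C in B_r by that arc shows that L_r has at least 2r + 1 + η vertices. Summing over r < s and counting
-- the antipode of the centre gives n ≥ s² + ηs + 1 ≥ k²/4.
module Submission where

open import Defs
open import Algebra.Bundles using (CommutativeRing)
open import Data.Bool using (Bool; true; false; not; _∧_; _xor_)
import Data.Bool.Properties as Bool
open import Data.Bool.Solver using (module xor-∧-Solver)
open import Data.Empty using (⊥-elim)
open import Data.Fin using (Fin; zero; suc; _<?_)
open import Data.Fin.Properties using (_≟_; any?; all?; <-cmp; injective⇒≤)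
open import Data.Fin.Subset.Properties using (anySubset?)
open import Data.List using (List; []; _∷_; _++_; length; applyUpTo; lookup)
open import Data.List.Properties using (length-applyUpTo; applyUpTo-∷ʳ; length-++)
open import Data.List.Relation.Unary.All as All using (All; []; _∷_)
import Data.List.Relation.Unary.All.Properties as All
open import Data.List.Relation.Unary.AllPairs using ([]; _∷_)
open import Data.List.Relation.Unary.Linked using (Linked)
import Data.List.Relation.Unary.Linked.Properties as Linked
open import Data.List.Relation.Unary.Unique.Propositional using (Unique)
import Data.List.Relation.Unary.Unique.Propositional.Properties as Unique
open import Data.List.Membership.Propositional.Properties using (∈-lookup)
open import Data.Nat using (ℕ; zero; suc; _+_; _*_; _∸_; _≤_; _<_; z≤n; s≤s; _≤′_; ≤′-refl; ≤′-step)
open import Data.Nat.Properties hiding (_≟_; <-cmp; _<?_)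
open import Data.Nat.Properties using () renaming (<-cmp to <-cmpᴺ)
open import Data.Nat.Induction using (<-rec)
open import Data.Nat.Solver using (module +-*-Solver)
open import Data.Product using (Σ; ∃-syntax; _×_; _,_; proj₁; proj₂)
open import Data.Sum using (_⊎_; inj₁; inj₂; [_,_]′)
open import Data.Vec as Vec using ()
open import Data.Vec.Properties using (lookup∘tabulate)
open import Function using (_∘_)
open import Relation.Binary.Construct.Closure.ReflexiveTransitive using (Star; ε; _◅_)
open import Relation.Binary.Construct.Closure.Symmetric using (fwd; bwd)
open import Relation.Binary.Definitions using (tri<; tri≈; tri>)
open import Relation.Binary.PropositionalEquality using (_≡_; _≢_; refl; sym; trans; cong; cong₂; subst)
open import Relation.Binary.PropositionalEquality using (module ≡-Reasoning)
open import Relation.Nullary using (¬_; Dec; yes; no; does; contradiction; ¬?)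
open import Relation.Nullary.Decidable using (_×-dec_; _⊎-dec_; map′; decidable-stable; dec-true; dec-false)
open import Relation.Unary using (Decidable)

open import Algebra.Properties.Semiring.Sum (CommutativeRing.semiring Bool.xor-∧-commutativeRing) as 𝔽₂ using (sum)
import Algebra.Properties.Semiring.Sum +-*-semiring as ℕΣ

open xor-∧-Solver using (_:+_; _:*_; _:=_) renaming (solve to xor-solve; con to bit)

-- Indicator functions and parities

opaque
  δ : ∀ {n} → Fin n → Fin n → Bool
  δ a b = does (a ≟ b)

  δ-refl : ∀ {n} (a : Fin n) → δ a a ≡ true
  δ-refl a = dec-true (a ≟ a) refl

  δ-sym : ∀ {n} (a b : Fin n) → δ a b ≡ δ b a
  δ-sym a b with a ≟ b | b ≟ a
  ... | yes _ | yes _ = refl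
  ... | yes p | no q = contradiction (sym p) q
  ... | no p | yes q = contradiction (sym q) p
  ... | no _ | no _ = refl

  δ-≢ : ∀ {n} {a b : Fin n} → a ≢ b → δ a b ≡ false
  δ-≢ {a = a} {b} = dec-false (a ≟ b)

  δ-true : ∀ {n} {a b : Fin n} → δ a b ≡ true → a ≡ b
  δ-true {a = a} {b} h with a ≟ b
  ... | yes p = p
  ... | no _ = contradiction h λ ()

∧-true : ∀ {x y} → x ∧ y ≡ true → x ≡ true × y ≡ true
∧-true {true} {true} _ = refl , refl

≢true⇒false : ∀ {b} → b ≢ true → b ≡ false
≢true⇒false {true} h = contradiction refl h
≢true⇒false {false} _ = refl

xor-false : ∀ {a b} → a xor b ≡ false → a ≡ b
xor-false {true} {true} _ = refl
xor-false {false} {false} _ = refl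

xor-true : ∀ {a b} → a xor b ≡ true → a ≡ true ⊎ b ≡ true
xor-true {true} _ = inj₁ refl
xor-true {false} h = inj₂ h

δ∧δ-true : ∀ {n} {a b c d : Fin n} → δ a b ∧ δ c d ≡ true → a ≡ b × c ≡ d
δ∧δ-true h = let (p , q) = ∧-true h in δ-true p , δ-true q

sum-false : ∀ {n} (f : Fin n → Bool) → (∀ i → f i ≡ false) → sum f ≡ false
sum-false {n} f h = trans (𝔽₂.sum-cong-≗ h) (𝔽₂.sum-replicate-zero n)

opaque
  unfolding δ

  sum-δ : ∀ {n} (f : Fin n → Bool) (x : Fin n) → sum (λ w → δ w x ∧ f w) ≡ f x
  sum-δ {suc n} f zero = trans (cong (f zero xor_) (sum-false {n} (λ _ → false) λ _ → refl)) (Bool.xor-identityʳ _)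
  sum-δ f (suc x) = sum-δ (f ∘ suc) x

[_]ᵇ : Bool → ℕ
[ true ]ᵇ = 1
[ false ]ᵇ = 0

parity : ℕ → Bool
parity zero = false
parity (suc k) = not (parity k)

parity-[]ᵇ : ∀ b k → parity ([ b ]ᵇ + k) ≡ b xor parity k
parity-[]ᵇ true k = refl
parity-[]ᵇ false k = refl

-- Links mod 2 sums to counts in ℕ, where a double count can be divided by 2.
parity-sum : ∀ {n} (f : Fin n → Bool) → parity (ℕΣ.sum ([_]ᵇ ∘ f)) ≡ sum f
parity-sum {zero} f = refl
parity-sum {suc n} f = trans (parity-[]ᵇ (f zero) _) (cong (f zero xor_) (parity-sum (f ∘ suc)))

ℕsum-zero : ∀ {n} (f : Fin n → ℕ) → (∀ i → f i ≡ 0) → ℕΣ.sum f ≡ 0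
ℕsum-zero {n} f h = trans (ℕΣ.sum-cong-≗ h) (ℕΣ.sum-replicate-zero n)

opaque
  unfolding δ

  ℕsum-δ : ∀ {n} (x : Fin n) → ℕΣ.sum (λ w → [ δ w x ]ᵇ) ≡ 1
  ℕsum-δ {suc n} zero = cong suc (ℕsum-zero {n} (λ _ → 0) λ _ → refl)
  ℕsum-δ (suc x) = ℕsum-δ x

  ℕsum-pair : ∀ {n} {i j : Fin n} (f : Fin n → Bool) → i ≢ j →
    (∀ k → f k ≡ δ k i xor δ k j) → ℕΣ.sum ([_]ᵇ ∘ f) ≡ 2
  ℕsum-pair {n} {i} {j} f i≢j h =
    trans (ℕΣ.sum-cong-≗ pointwise)
      (trans (ℕΣ.∑-distrib-+ (λ k → [ δ k i ]ᵇ) (λ k → [ δ k j ]ᵇ)) (cong₂ _+_ (ℕsum-δ i) (ℕsum-δ j)))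
    where
    pointwise : ∀ k → [ f k ]ᵇ ≡ [ δ k i ]ᵇ + [ δ k j ]ᵇ
    pointwise k rewrite h k with k ≟ i | k ≟ j
    ... | yes p | yes q = contradiction (trans (sym p) q) i≢j
    ... | yes _ | no _ = refl
    ... | no _ | yes _ = refl
    ... | no _ | no _ = refl

opaque
  -- In use, `f` marks the two faces on an edge, so that a sum over all faces reduces to these two.
  sum-pair : ∀ {n} {i j : Fin n} (g f : Fin n → Bool) →
    (∀ k → f k ≡ δ k i xor δ k j) → sum (λ k → g k ∧ f k) ≡ g i xor g j
  sum-pair {n} {i} {j} g f h =
    trans (𝔽₂.sum-cong-≗ λ k → trans (cong (g k ∧_) (h k))
        (xor-solve 3 (λ g i j → g :* (i :+ j) := i :* g :+ j :* g) refl (g k) (δ k i) (δ k j)))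
      (trans (𝔽₂.∑-distrib-+ (λ k → δ k i ∧ g k) (λ k → δ k j ∧ g k)) (cong₂ _xor_ (sum-δ g i) (sum-δ g j)))

opaque
  sum-δδ : ∀ {n} (f : Fin n → Fin n → Bool) (a b : Fin n) →
    sum (λ u → sum (λ w → f u w ∧ (δ a u ∧ δ b w))) ≡ f a b
  sum-δδ f a b = trans (𝔽₂.sum-cong-≗ inner) (sum-δ (λ u → f u b) a)
    where
    inner : ∀ u → sum (λ w → f u w ∧ (δ a u ∧ δ b w)) ≡ δ u a ∧ f u b
    inner u = trans (𝔽₂.sum-cong-≗ λ w → trans
        (cong (f u w ∧_) (cong₂ _∧_ (δ-sym a u) (δ-sym b w)))
        (xor-solve 3 (λ f a b → f :* (a :* b) := a :* (b :* f)) refl (f u w) (δ u a) (δ w b)))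
      (trans (sym (𝔽₂.*-distribˡ-sum (δ u a) (λ w → δ w b ∧ f u w))) (cong (δ u a ∧_) (sum-δ (f u) b)))

unique-length : ∀ {n} {xs : List (Fin n)} → Unique xs → length xs ≤ n
unique-length uniq = injective⇒≤ (lookup-injective uniq)
  where
  lookup-injective : ∀ {n} {xs : List (Fin n)} → Unique xs → ∀ {i j} → lookup xs i ≡ lookup xs j → i ≡ j
  lookup-injective (_ ∷ _) {zero} {zero} _ = refl
  lookup-injective {xs = _ ∷ xs} (x∉ ∷ _) {zero} {suc j} h = contradiction h (All.lookup x∉ (∈-lookup j))
  lookup-injective {xs = _ ∷ xs} (x∉ ∷ _) {suc i} {zero} h = contradiction (sym h) (All.lookup x∉ (∈-lookup i))
  lookup-injective (_ ∷ uniq) {suc i} {suc j} h = cong suc (lookup-injective uniq h)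

-- Mod 2 chains of a triangulation

-- A mod 2 1-chain is stored on ordered pairs; it is symmetric with zero diagonal if it comes from
-- undirected edges. The row sum `sum (c a)` is then the coefficient of its boundary at `a`, and a
-- cycle is a chain whose row sums all vanish.
Chain : ℕ → Set
Chain n = Fin n → Fin n → Bool

_≐_ : ∀ {n} → Chain n → Chain n → Set
c ≐ d = ∀ a b → c a b ≡ d a b

infixl 6 _⊞_
_⊞_ : ∀ {n} → Chain n → Chain n → Chain n
(c ⊞ d) a b = c a b xor d a b

0ᶜ : ∀ {n} → Chain n
0ᶜ _ _ = false

edge : ∀ {n} → Fin n → Fin n → Chain n
edge x y a b = (δ a x ∧ δ b y) xor (δ a y ∧ δ b x)

edge-sym : ∀ {n} (x y : Fin n) → edge x y ≐ edge y x
edge-sym x y a b = Bool.xor-comm (δ a x ∧ δ b y) _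

triangle : ∀ {n} → Fin n → Fin n → Fin n → Chain n
triangle x y z = edge x y ⊞ edge y z ⊞ edge z x

-- The directed counterpart of `triangle`, which is this chain plus its transpose.
arrows : ∀ {n} → Fin n → Fin n → Fin n → Chain n
arrows x y z a b = ((δ a x ∧ δ b y) xor (δ a y ∧ δ b z)) xor (δ a z ∧ δ b x)

opaque
  edge-flip : ∀ {n} (x y a b : Fin n) → edge x y a b ≡ edge x y b a
  edge-flip x y a b =
    xor-solve 4 (λ ax bx ay by → ax :* by :+ ay :* bx := bx :* ay :+ by :* ax) refl (δ a x) (δ b x) (δ a y) (δ b y)

  sum-edge : ∀ {n} (x y a : Fin n) → sum (edge x y a) ≡ δ a x xor δ a y
  sum-edge x y a =
    trans (𝔽₂.sum-cong-≗ λ b → cong₂ _xor_ (Bool.∧-comm (δ a x) (δ b y)) (Bool.∧-comm (δ a y) (δ b x)))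
      (trans (𝔽₂.∑-distrib-+ (λ b → δ b y ∧ δ a x) (λ b → δ b x ∧ δ a y))
        (cong₂ _xor_ (sum-δ (λ _ → δ a x) y) (sum-δ (λ _ → δ a y) x)))

  edge-on : ∀ {n} {x y : Fin n} → x ≢ y → edge x y x y ≡ true
  edge-on {x = x} {y} x≢y = cong₂ _xor_ (cong₂ _∧_ (δ-refl x) (δ-refl y)) (cong (_∧ δ y x) (δ-≢ x≢y))

  edge-off : ∀ {n} {x y a : Fin n} → a ≢ x → a ≢ y → ∀ b → edge x y a b ≡ false
  edge-off {x = x} {y} a≢x a≢y b = cong₂ _xor_ (cong (_∧ δ b y) (δ-≢ a≢x)) (cong (_∧ δ b x) (δ-≢ a≢y))

  triangle-rot : ∀ {n} (x y z : Fin n) → triangle x y z ≐ triangle y z x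
  triangle-rot x y z a b =
    xor-solve 3 (λ e f g → e :+ f :+ g := f :+ g :+ e) refl (edge x y a b) (edge y z a b) (edge z x a b)

  triangle-swap : ∀ {n} (x y z : Fin n) → triangle x y z ≐ triangle y x z
  triangle-swap x y z a b rewrite edge-sym x y a b | edge-sym y z a b | edge-sym z x a b =
    xor-solve 3 (λ e f g → e :+ f :+ g := e :+ g :+ f) refl (edge y x a b) (edge z y a b) (edge x z a b)

  triangle-flip : ∀ {n} (x y z a b : Fin n) → triangle x y z a b ≡ triangle x y z b a
  triangle-flip x y z a b = cong₂ _xor_ (cong₂ _xor_ (edge-flip x y a b) (edge-flip y z a b)) (edge-flip z x a b)

  triangle-on : ∀ {n} {x y z : Fin n} → x ≢ y → y ≢ z → x ≢ z → triangle x y z x y ≡ true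
  triangle-on {x = x} {y} {z} x≢y y≢z x≢z = cong₂ _xor_ (cong₂ _xor_ (edge-on x≢y) (edge-off x≢y x≢z y))
    (trans (edge-flip z x x y) (edge-off y≢z (x≢y ∘ sym) x))

  sum-triangle : ∀ {n} (x y z a : Fin n) → sum (triangle x y z a) ≡ false
  sum-triangle x y z a = trans (𝔽₂.∑-distrib-+ (λ b → edge x y a b xor edge y z a b) (edge z x a))
    (trans (cong₂ _xor_ (trans (𝔽₂.∑-distrib-+ (edge x y a) (edge y z a))
        (cong₂ _xor_ (sum-edge x y a) (sum-edge y z a))) (sum-edge z x a))
      (xor-solve 3 (λ x y z → (x :+ y) :+ (y :+ z) :+ (z :+ x) := bit false) refl (δ a x) (δ a y) (δ a z)))

  triangle-edge : ∀ {n} {x y z a b : Fin n} → x ≢ y → y ≢ z → x ≢ z →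
    a ≡ x ⊎ a ≡ y ⊎ a ≡ z → b ≡ x ⊎ b ≡ y ⊎ b ≡ z → a ≢ b → triangle x y z a b ≡ true
  triangle-edge {x = x} {y} {z} x≢y y≢z x≢z = λ where
    (inj₁ refl) (inj₁ refl) a≢b → contradiction refl a≢b
    (inj₂ (inj₁ refl)) (inj₂ (inj₁ refl)) a≢b → contradiction refl a≢b
    (inj₂ (inj₂ refl)) (inj₂ (inj₂ refl)) a≢b → contradiction refl a≢b
    (inj₁ refl) (inj₂ (inj₁ refl)) _ → triangle-on x≢y y≢z x≢z
    (inj₂ (inj₁ refl)) (inj₂ (inj₂ refl)) _ →
      trans (triangle-rot x y z y z) (triangle-on y≢z (x≢z ∘ sym) (x≢y ∘ sym))
    (inj₂ (inj₂ refl)) (inj₁ refl) _ →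
      trans (sym (triangle-rot z x y z x)) (triangle-on (x≢z ∘ sym) x≢y (y≢z ∘ sym))
    (inj₂ (inj₁ refl)) (inj₁ refl) _ → trans (triangle-flip x y z y x) (triangle-on x≢y y≢z x≢z)
    (inj₂ (inj₂ refl)) (inj₂ (inj₁ refl)) _ → trans (triangle-flip x y z z y)
      (trans (triangle-rot x y z y z) (triangle-on y≢z (x≢z ∘ sym) (x≢y ∘ sym)))
    (inj₁ refl) (inj₂ (inj₂ refl)) _ → trans (triangle-flip x y z x z)
      (trans (sym (triangle-rot z x y z x)) (triangle-on (x≢z ∘ sym) x≢y (y≢z ∘ sym)))

  triangle-unique : ∀ {n} {x y z u v w : Fin n} → u ≢ v → v ≢ w → u ≢ w →
    u ≡ x ⊎ u ≡ y ⊎ u ≡ z → v ≡ x ⊎ v ≡ y ⊎ v ≡ z → w ≡ x ⊎ w ≡ y ⊎ w ≡ z →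
    triangle u v w ≐ triangle x y z
  triangle-unique {x = x} {y} {z} u≢v v≢w u≢w = λ where
    (inj₁ refl) (inj₁ refl) _ → contradiction refl u≢v
    (inj₂ (inj₁ refl)) (inj₂ (inj₁ refl)) _ → contradiction refl u≢v
    (inj₂ (inj₂ refl)) (inj₂ (inj₂ refl)) _ → contradiction refl u≢v
    (inj₁ refl) _ (inj₁ refl) → contradiction refl u≢w
    (inj₂ (inj₁ refl)) _ (inj₂ (inj₁ refl)) → contradiction refl u≢w
    (inj₂ (inj₂ refl)) _ (inj₂ (inj₂ refl)) → contradiction refl u≢w
    _ (inj₁ refl) (inj₁ refl) → contradiction refl v≢w
    _ (inj₂ (inj₁ refl)) (inj₂ (inj₁ refl)) → contradiction refl v≢w
    _ (inj₂ (inj₂ refl)) (inj₂ (inj₂ refl)) → contradiction refl v≢w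
    (inj₁ refl) (inj₂ (inj₁ refl)) (inj₂ (inj₂ refl)) a b → refl
    (inj₂ (inj₁ refl)) (inj₂ (inj₂ refl)) (inj₁ refl) a b → sym (triangle-rot x y z a b)
    (inj₂ (inj₂ refl)) (inj₁ refl) (inj₂ (inj₁ refl)) a b → triangle-rot z x y a b
    (inj₂ (inj₁ refl)) (inj₁ refl) (inj₂ (inj₂ refl)) a b → triangle-swap y x z a b
    (inj₁ refl) (inj₂ (inj₂ refl)) (inj₂ (inj₁ refl)) a b →
      trans (triangle-swap x z y a b) (triangle-rot z x y a b)
    (inj₂ (inj₂ refl)) (inj₂ (inj₁ refl)) (inj₁ refl) a b →
      trans (triangle-swap z y x a b) (sym (triangle-rot x y z a b))

  triangle-row : ∀ {n} {x y z : Fin n} → x ≢ y → x ≢ z → ∀ b → triangle x y z x b ≡ δ b y xor δ b z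
  triangle-row {x = x} {y} {z} x≢y x≢z b rewrite δ-refl x | δ-≢ x≢y | δ-≢ x≢z =
    cong (_xor δ b z) (trans (Bool.xor-identityʳ (δ b y xor false)) (Bool.xor-identityʳ (δ b y)))

  twice-cong : ∀ {p q r p′ q′ r′} → p ≡ p′ → q ≡ q′ → r ≡ r′ →
    2 * [ (p xor q) xor r ]ᵇ ≡ 2 * [ (p′ xor q′) xor r′ ]ᵇ
  twice-cong refl refl refl = refl

  -- A corner lies on two sides and any other vertex on none; as the corners are distinct, the xor
  -- on the right is the indicator of being a corner.
  triangle-degree : ∀ {n} {x y z : Fin n} → x ≢ y → y ≢ z → x ≢ z → ∀ a →
    ℕΣ.sum (λ b → [ triangle x y z a b ]ᵇ) ≡ 2 * [ (δ a x xor δ a y) xor δ a z ]ᵇ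
  triangle-degree {x = x} {y} {z} x≢y y≢z x≢z a with a ≟ x | a ≟ y | a ≟ z
  ... | yes refl | _ | _ =
    trans (ℕsum-pair (triangle a y z a) y≢z (triangle-row x≢y x≢z))
      (sym (twice-cong (δ-refl a) (δ-≢ x≢y) (δ-≢ x≢z)))
  ... | no a≢x | yes refl | _ =
    trans (ℕsum-pair (triangle x a z a) (x≢z ∘ sym) λ b → trans (triangle-rot x a z a b) (triangle-row y≢z a≢x b))
      (sym (twice-cong (δ-≢ a≢x) (δ-refl a) (δ-≢ y≢z)))
  ... | no a≢x | no a≢y | yes refl =
    trans (ℕsum-pair (triangle x y a a) x≢y λ b → trans (sym (triangle-rot a x y a b)) (triangle-row a≢x a≢y b))
      (sym (twice-cong (δ-≢ a≢x) (δ-≢ a≢y) (δ-refl a)))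
  ... | no a≢x | no a≢y | no a≢z =
    trans (ℕsum-zero _ λ b → cong [_]ᵇ
        (cong₂ _xor_ (cong₂ _xor_ (edge-off a≢x a≢y b) (edge-off a≢y a≢z b)) (edge-off a≢z a≢x b)))
      (sym (twice-cong (δ-≢ a≢x) (δ-≢ a≢y) (δ-≢ a≢z)))

  arrows-on : ∀ {n} {x y z : Fin n} → x ≢ y → x ≢ z → arrows x y z x y ≡ true
  arrows-on {x = x} {y} x≢y x≢z rewrite δ-refl x | δ-refl y | δ-≢ x≢y | δ-≢ x≢z = refl

  arrows-rot : ∀ {n} (x y z : Fin n) → arrows x y z ≐ arrows y z x
  arrows-rot x y z a b =
    xor-solve 3 (λ e f g → e :+ f :+ g := f :+ g :+ e) refl (δ a x ∧ δ b y) (δ a y ∧ δ b z) (δ a z ∧ δ b x)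

  sum-arrows : ∀ {n} (x y z a : Fin n) → sum (arrows x y z a) ≡ (δ a x xor δ a y) xor δ a z
  sum-arrows {n} x y z a = begin
    sum (λ b → (A b xor B b) xor C b) ≡⟨ 𝔽₂.∑-distrib-+ (λ b → A b xor B b) C ⟩
    sum (λ b → A b xor B b) xor sum C ≡⟨ cong (_xor sum C) (𝔽₂.∑-distrib-+ A B) ⟩
    (sum A xor sum B) xor sum C ≡⟨ cong₂ _xor_ (cong₂ _xor_ (row x y) (row y z)) (row z x) ⟩
    (δ a x xor δ a y) xor δ a z ∎
    where
    open ≡-Reasoning
    A B C : Fin n → Bool
    A b = δ a x ∧ δ b y
    B b = δ a y ∧ δ b z
    C b = δ a z ∧ δ b x
    row : (v w : Fin n) → sum (λ b → δ a v ∧ δ b w) ≡ δ a v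
    row v w = trans (𝔽₂.sum-cong-≗ λ b → Bool.∧-comm (δ a v) (δ b w)) (sum-δ (λ _ → δ a v) w)

-- Faces, their arcs and their boundary chains

module Surface {n : ℕ} (T : Triangulation n) where

  open Triangulation T

  _∈_ : Fin n → Fin m → Set
  v ∈ i = _∈F_ face v i

  _~_ : Fin n → Fin n → Set
  _~_ = Adj face

  corner₁ corner₂ corner₃ : Fin m → Fin n
  corner₁ i = proj₁ (face i)
  corner₂ i = proj₁ (proj₂ (face i))
  corner₃ i = proj₂ (proj₂ (face i))

  opaque
    _∈?_ : ∀ v i → Dec (v ∈ i)
    v ∈? i = v ≟ corner₁ i ⊎-dec v ≟ corner₂ i ⊎-dec v ≟ corner₃ i

    _~?_ : ∀ u v → Dec (u ~ v)
    u ~? v = ¬? (u ≟ v) ×-dec any? (λ i → u ∈? i ×-dec v ∈? i)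

  ~-sym : ∀ {u v} → u ~ v → v ~ u
  ~-sym (u≢v , i , u∈i , v∈i) = u≢v ∘ sym , i , v∈i , u∈i

  opaque
    arc : Fin m → Chain n
    arc i = arrows (corner₁ i) (corner₂ i) (corner₃ i)

    ∂ᶠ : Fin m → Chain n
    ∂ᶠ i = triangle (corner₁ i) (corner₂ i) (corner₃ i)

  opaque
    unfolding arc

    ∂ᶠ-arc : ∀ i a b → ∂ᶠ i a b ≡ arc i a b xor arc i b a
    ∂ᶠ-arc i a b = xor-solve 6
      (λ ax ay az bx by bz →
        (ax :* by :+ ay :* bx) :+ (ay :* bz :+ az :* by) :+ (az :* bx :+ ax :* bz) :=
        (ax :* by :+ ay :* bz :+ az :* bx) :+ (bx :* ay :+ by :* az :+ bz :* ax)) refl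
      (δ a (corner₁ i)) (δ a (corner₂ i)) (δ a (corner₃ i)) (δ b (corner₁ i)) (δ b (corner₂ i)) (δ b (corner₃ i))

    sum-∂ᶠ : ∀ i a → sum (∂ᶠ i a) ≡ false
    sum-∂ᶠ i = sum-triangle (corner₁ i) (corner₂ i) (corner₃ i)

    arc-true : ∀ i {a b} → arc i a b ≡ true →
      (a ≡ corner₁ i × b ≡ corner₂ i) ⊎ (a ≡ corner₂ i × b ≡ corner₃ i) ⊎ (a ≡ corner₃ i × b ≡ corner₁ i)
    arc-true i h with xor-true h
    ... | inj₂ h₃ = inj₂ (inj₂ (δ∧δ-true h₃))
    ... | inj₁ h₁₂ with xor-true h₁₂
    ... | inj₁ h₁ = inj₁ (δ∧δ-true h₁)
    ... | inj₂ h₂ = inj₂ (inj₁ (δ∧δ-true h₂))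

    ∂ᶠ-edge : ∀ i {a b} → a ∈ i → b ∈ i → a ≢ b → ∂ᶠ i a b ≡ true
    ∂ᶠ-edge i = let (x≢y , y≢z , x≢z) = proper i in triangle-edge x≢y y≢z x≢z

    ∂ᶠ-unique : ∀ i {u v w} → u ∈ i → v ∈ i → w ∈ i → u ≢ v → v ≢ w → u ≢ w → triangle u v w ≐ ∂ᶠ i
    ∂ᶠ-unique i u∈ v∈ w∈ u≢v v≢w u≢w = triangle-unique u≢v v≢w u≢w u∈ v∈ w∈

    -- The indicator of `a ∈ i`, since at most one of the three terms is true for distinct corners.
    member : Fin m → Fin n → Bool
    member i a = (δ a (corner₁ i) xor δ a (corner₂ i)) xor δ a (corner₃ i)

    ∂ᶠ-degree : ∀ i a → ℕΣ.sum (λ b → [ ∂ᶠ i a b ]ᵇ) ≡ 2 * [ member i a ]ᵇ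
    ∂ᶠ-degree i = let (x≢y , y≢z , x≢z) = proper i in triangle-degree x≢y y≢z x≢z

    sum-arc : ∀ i a → sum (arc i a) ≡ member i a
    sum-arc i = sum-arrows (corner₁ i) (corner₂ i) (corner₃ i)

    dir⇒arc : ∀ i {a b} → DirEdge face true i a b → arc i a b ≡ true
    dir⇒arc i (inj₁ (refl , refl)) = let (x≢y , y≢z , x≢z) = proper i in arrows-on x≢y x≢z
    dir⇒arc i (inj₂ (inj₁ (refl , refl))) = let (x≢y , y≢z , x≢z) = proper i in
      trans (arrows-rot (corner₁ i) (corner₂ i) (corner₃ i) (corner₂ i) (corner₃ i)) (arrows-on y≢z (x≢y ∘ sym))
    dir⇒arc i (inj₂ (inj₂ (refl , refl))) = let (x≢y , y≢z , x≢z) = proper i in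
      trans (sym (arrows-rot (corner₃ i) (corner₁ i) (corner₂ i) (corner₃ i) (corner₁ i)))
        (arrows-on (x≢z ∘ sym) (y≢z ∘ sym))

  opaque
    ∂ᶠ-flip : ∀ i a b → ∂ᶠ i a b ≡ ∂ᶠ i b a
    ∂ᶠ-flip i a b = trans (∂ᶠ-arc i a b) (trans (Bool.xor-comm (arc i a b) _) (sym (∂ᶠ-arc i b a)))

    ∂ᶠ-irrefl : ∀ i a → ∂ᶠ i a a ≡ false
    ∂ᶠ-irrefl i a = trans (∂ᶠ-arc i a a) (Bool.xor-same (arc i a a))

  opaque
    arc-∈ : ∀ i {a b} → arc i a b ≡ true → a ∈ i × b ∈ i
    arc-∈ i h with arc-true i h
    ... | inj₁ (p , q) = inj₁ p , inj₂ (inj₁ q)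
    ... | inj₂ (inj₁ (p , q)) = inj₂ (inj₁ p) , inj₂ (inj₂ q)
    ... | inj₂ (inj₂ (p , q)) = inj₂ (inj₂ p) , inj₁ q

    arc-≢ : ∀ i {a b} → arc i a b ≡ true → a ≢ b
    arc-≢ i h refl with arc-true i h
    ... | inj₁ (p , q) = proj₁ (proper i) (trans (sym p) q)
    ... | inj₂ (inj₁ (p , q)) = proj₁ (proj₂ (proper i)) (trans (sym p) q)
    ... | inj₂ (inj₂ (p , q)) = proj₂ (proj₂ (proper i)) (trans (sym q) p)

  opaque
    ∂ᶠ-∈ : ∀ i {a b} → ∂ᶠ i a b ≡ true → a ∈ i × b ∈ i
    ∂ᶠ-∈ i {a} {b} h with xor-true {arc i a b} (trans (sym (∂ᶠ-arc i a b)) h)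
    ... | inj₁ p = arc-∈ i p
    ... | inj₂ q = let (b∈ , a∈) = arc-∈ i q in a∈ , b∈

  ∂ : (Fin m → Bool) → Chain n
  ∂ S a b = sum (λ i → S i ∧ ∂ᶠ i a b)

  opaque
    -- Recasts `edgeTwo` as an equation of indicators, the form that `sum-pair` takes.
    two-faces : ∀ {u v} → u ~ v → ∃[ i ] ∃[ j ] (i ≢ j × ∀ k → ∂ᶠ k u v ≡ δ k i xor δ k j)
    two-faces {u} {v} adj@(u≢v , _) with edgeTwo u v adj
    ... | i , j , i≢j , (u∈i , v∈i) , (u∈j , v∈j) , only = i , j , i≢j , spec
      where
      spec : ∀ k → ∂ᶠ k u v ≡ δ k i xor δ k j
      spec k with k ≟ i | k ≟ j
      ... | yes p | yes q = contradiction (trans (sym p) q) i≢j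
      ... | yes refl | no k≢j rewrite δ-refl k | δ-≢ k≢j = ∂ᶠ-edge k u∈i v∈i u≢v
      ... | no k≢i | yes refl rewrite δ-refl k | δ-≢ k≢i = ∂ᶠ-edge k u∈j v∈j u≢v
      ... | no k≢i | no k≢j rewrite δ-≢ k≢i | δ-≢ k≢j = ≢true⇒false λ h →
        [ k≢i , k≢j ]′ (only k (proj₁ (∂ᶠ-∈ k h)) (proj₂ (∂ᶠ-∈ k h)))

  δ-pair : ∀ {i j k : Fin m} → δ k i xor δ k j ≡ true → k ≡ i ⊎ k ≡ j
  δ-pair h with xor-true h
  ... | inj₁ p = inj₁ (δ-true p)
  ... | inj₂ q = inj₂ (δ-true q)

  opaque
    -- Both `i` and `j` occur in the pair given by `two-faces`; being distinct, they are that pair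
    -- up to order.
    edge-faces : ∀ {u v i j} → i ≢ j → u ≢ v → u ∈ i → v ∈ i → u ∈ j → v ∈ j →
      ∀ k → ∂ᶠ k u v ≡ δ k i xor δ k j
    edge-faces {u} {v} {i} {j} i≢j u≢v u∈i v∈i u∈j v∈j k
      with two-faces (u≢v , i , u∈i , v∈i)
    ... | i′ , j′ , _ , spec
      with δ-pair (trans (sym (spec i)) (∂ᶠ-edge i u∈i v∈i u≢v)) | δ-pair (trans (sym (spec j)) (∂ᶠ-edge j u∈j v∈j u≢v))
    ... | inj₁ refl | inj₁ refl = contradiction refl i≢j
    ... | inj₁ refl | inj₂ refl = spec k
    ... | inj₂ refl | inj₁ refl = trans (spec k) (Bool.xor-comm (δ k i′) _)
    ... | inj₂ refl | inj₂ refl = contradiction refl i≢j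

  ∂-edge : ∀ S {u v i j} → i ≢ j → u ≢ v → u ∈ i → v ∈ i → u ∈ j → v ∈ j → ∂ S u v ≡ S i xor S j
  ∂-edge S {u} {v} {i} {j} i≢j u≢v u∈i v∈i u∈j v∈j =
    sum-pair {i = i} {j} S (λ k → ∂ᶠ k u v) (edge-faces i≢j u≢v u∈i v∈i u∈j v∈j)

  -- Chains that bound a set of faces

  Bounds : Chain n → Set
  Bounds c = ∃[ S ] c ≐ ∂ S

  opaque
    ∂-⊞ : ∀ S S′ → ∂ (λ i → S i xor S′ i) ≐ (∂ S ⊞ ∂ S′)
    ∂-⊞ S S′ a b = trans (𝔽₂.sum-cong-≗ λ i → Bool.∧-distribʳ-xor (∂ᶠ i a b) (S i) (S′ i))
      (𝔽₂.∑-distrib-+ (λ i → S i ∧ ∂ᶠ i a b) (λ i → S′ i ∧ ∂ᶠ i a b))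

    -- This is ∂∂ = 0, checked on each triangle.
    sum-∂ : ∀ S a → sum (∂ S a) ≡ false
    sum-∂ S a = trans (𝔽₂.∑-comm (λ b i → S i ∧ ∂ᶠ i a b)) (sum-false _ λ i →
      trans (sym (𝔽₂.*-distribˡ-sum (S i) (∂ᶠ i a))) (trans (cong (S i ∧_) (sum-∂ᶠ i a)) (Bool.∧-zeroʳ (S i))))

    ∂-flip : ∀ S a b → ∂ S a b ≡ ∂ S b a
    ∂-flip S a b = 𝔽₂.sum-cong-≗ λ i → cong (S i ∧_) (∂ᶠ-flip i a b)

    ∂-irrefl : ∀ S a → ∂ S a a ≡ false
    ∂-irrefl S a = sum-false _ λ i → trans (cong (S i ∧_) (∂ᶠ-irrefl i a)) (Bool.∧-zeroʳ (S i))

  Bounds-⊞ : ∀ {c d e} → Bounds c → Bounds d → e ≐ (c ⊞ d) → Bounds e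
  Bounds-⊞ (S , p) (S′ , q) r = (λ i → S i xor S′ i) ,
    λ a b → trans (r a b) (trans (cong₂ _xor_ (p a b) (q a b)) (sym (∂-⊞ S S′ a b)))

  Bounds-≐ : ∀ {c d} → d ≐ c → Bounds c → Bounds d
  Bounds-≐ r (S , p) = S , λ a b → trans (r a b) (p a b)

  Bounds-0 : Bounds 0ᶜ
  Bounds-0 = (λ _ → false) , λ a b → sym (sum-false {m} (λ _ → false) λ _ → refl)

  Bounds-face : ∀ i → Bounds (∂ᶠ i)
  Bounds-face i = (λ k → δ k i) , λ a b → sym (sum-δ (λ k → ∂ᶠ k a b) i)

  Bounds-∧ : ∀ b {c} → (b ≡ true → Bounds c) → Bounds (λ u v → b ∧ c u v)
  Bounds-∧ true h = h refl
  Bounds-∧ false _ = Bounds-0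

  Bounds-sum : ∀ {k} (c : Fin k → Chain n) → (∀ j → Bounds (c j)) → Bounds (λ a b → sum (λ j → c j a b))
  Bounds-sum {zero} c _ = Bounds-0
  Bounds-sum {suc k} c h = Bounds-⊞ (h zero) (Bounds-sum (c ∘ suc) (h ∘ suc)) (λ _ _ → refl)

  opaque
    -- There are finitely many sets of faces to try. Decidability is what permits the indirect
    -- arguments and the choice of a shortest non-bounding walk.
    bounds? : ∀ c → Dec (Bounds c)
    bounds? c = map′
      (λ (p , h) → Vec.lookup p , h)
      (λ (S , h) → Vec.tabulate S , λ a b → trans (h a b)
        (𝔽₂.sum-cong-≗ λ i → cong (_∧ ∂ᶠ i a b) (sym (lookup∘tabulate S i))))
      (anySubset? λ p → all? λ a → all? λ b → c a b Bool.≟ ∂ (Vec.lookup p) a b)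

  -- In Σ_{u<w} z(u,w) (P u + uw + P w) each P u occurs as often as the degree of u in the cycle z, hence cancels.
  opaque
    cycle-bounds : (z : Chain n) (P : Fin n → Chain n) → (∀ a → z a a ≡ false) → (∀ a b → z a b ≡ z b a) →
      (∀ u → sum (z u) ≡ false) → (∀ u w → z u w ≡ true → Bounds (P u ⊞ edge u w ⊞ P w)) → Bounds z
    cycle-bounds z P irr symm closed fund = Bounds-≐ (λ a b → sym (total a b))
      (Bounds-sum (λ u a b → sum λ w → z< u w ∧ (P u ⊞ edge u w ⊞ P w) a b)
        λ u → Bounds-sum (λ w a b → z< u w ∧ (P u ⊞ edge u w ⊞ P w) a b)
        λ w → Bounds-∧ (z< u w) λ h → fund u w (proj₂ (∧-true h)))
      where
      z< : Chain n
      z< u w = does (u <? w) ∧ z u w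

      z<-sym : ∀ u w → z u w ≡ z< u w xor z< w u
      z<-sym u w with <-cmp u w
      ... | tri< p _ q rewrite dec-true (u <? w) p | dec-false (w <? u) q = sym (Bool.xor-identityʳ _)
      ... | tri≈ p refl q rewrite dec-false (u <? u) p = irr u
      ... | tri> p _ q rewrite dec-false (u <? w) p | dec-true (w <? u) q = symm u w

      ends : (p : Fin n → Bool) →
        sum (λ u → sum λ w → z< u w ∧ p u) xor sum (λ u → sum λ w → z< u w ∧ p w) ≡ false
      ends p = begin
        sum (λ u → sum λ w → z< u w ∧ p u) xor sum (λ u → sum λ w → z< u w ∧ p w)
          ≡⟨ cong (sum (λ u → sum λ w → z< u w ∧ p u) xor_) (𝔽₂.∑-comm (λ u w → z< u w ∧ p w)) ⟩
        sum (λ u → sum λ w → z< u w ∧ p u) xor sum (λ u → sum λ w → z< w u ∧ p u)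
          ≡⟨ 𝔽₂.∑-distrib-+ (λ u → sum λ w → z< u w ∧ p u) (λ u → sum λ w → z< w u ∧ p u) ⟨
        sum (λ u → sum (λ w → z< u w ∧ p u) xor sum λ w → z< w u ∧ p u)
          ≡⟨ sum-false _ vanish ⟩
        false ∎
        where
        open ≡-Reasoning
        vanish : ∀ u → sum (λ w → z< u w ∧ p u) xor sum (λ w → z< w u ∧ p u) ≡ false
        vanish u = begin
          sum (λ w → z< u w ∧ p u) xor sum (λ w → z< w u ∧ p u)
            ≡⟨ 𝔽₂.∑-distrib-+ (λ w → z< u w ∧ p u) (λ w → z< w u ∧ p u) ⟨
          sum (λ w → (z< u w ∧ p u) xor (z< w u ∧ p u))
            ≡⟨ 𝔽₂.sum-cong-≗ (λ w → trans (sym (Bool.∧-distribʳ-xor (p u) (z< u w) (z< w u)))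
                 (cong (_∧ p u) (sym (z<-sym u w)))) ⟩
          sum (λ w → z u w ∧ p u)
            ≡⟨ 𝔽₂.*-distribʳ-sum (p u) (z u) ⟨
          sum (z u) ∧ p u
            ≡⟨ cong (_∧ p u) (closed u) ⟩
          false ∎

      middle : ∀ a b → sum (λ u → sum λ w → z< u w ∧ edge u w a b) ≡ z a b
      middle a b = begin
        sum (λ u → sum λ w → z< u w ∧ edge u w a b)
          ≡⟨ 𝔽₂.sum-cong-≗ (λ u → trans (𝔽₂.sum-cong-≗ λ w → trans
               (Bool.∧-distribˡ-xor (z< u w) (δ a u ∧ δ b w) (δ a w ∧ δ b u))
               (cong ((z< u w ∧ (δ a u ∧ δ b w)) xor_) (cong (z< u w ∧_) (Bool.∧-comm (δ a w) (δ b u)))))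
               (𝔽₂.∑-distrib-+ (λ w → z< u w ∧ (δ a u ∧ δ b w)) (λ w → z< u w ∧ (δ b u ∧ δ a w)))) ⟩
        sum (λ u → sum (λ w → z< u w ∧ (δ a u ∧ δ b w)) xor sum (λ w → z< u w ∧ (δ b u ∧ δ a w)))
          ≡⟨ 𝔽₂.∑-distrib-+ (λ u → sum λ w → z< u w ∧ (δ a u ∧ δ b w)) (λ u → sum λ w → z< u w ∧ (δ b u ∧ δ a w)) ⟩
        sum (λ u → sum (λ w → z< u w ∧ (δ a u ∧ δ b w))) xor sum (λ u → sum (λ w → z< u w ∧ (δ b u ∧ δ a w)))
          ≡⟨ cong₂ _xor_ (sum-δδ z< a b) (sum-δδ z< b a) ⟩
        z< a b xor z< b a
          ≡⟨ z<-sym a b ⟨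
        z a b ∎
        where open ≡-Reasoning

      total : ∀ a b → sum (λ u → sum λ w → z< u w ∧ (P u ⊞ edge u w ⊞ P w) a b) ≡ z a b
      total a b = begin
        sum (λ u → sum λ w → z< u w ∧ (P u ⊞ edge u w ⊞ P w) a b)
          ≡⟨ 𝔽₂.sum-cong-≗ (λ u → trans (𝔽₂.sum-cong-≗ λ w →
               xor-solve 4 (λ z p e q → z :* (p :+ e :+ q) := (z :* p :+ z :* q) :+ z :* e) refl
                 (z< u w) (P u a b) (edge u w a b) (P w a b))
               (trans (𝔽₂.∑-distrib-+ (λ w → (z< u w ∧ P u a b) xor (z< u w ∧ P w a b)) (λ w → z< u w ∧ edge u w a b))
                 (cong (_xor sum (λ w → z< u w ∧ edge u w a b))
                   (𝔽₂.∑-distrib-+ (λ w → z< u w ∧ P u a b) (λ w → z< u w ∧ P w a b))))) ⟩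
        sum (λ u → (A u xor B u) xor C u)
          ≡⟨ 𝔽₂.∑-distrib-+ (λ u → A u xor B u) C ⟩
        sum (λ u → A u xor B u) xor sum C
          ≡⟨ cong₂ _xor_ (trans (𝔽₂.∑-distrib-+ A B) (ends λ u → P u a b)) (middle a b) ⟩
        z a b ∎
        where
        open ≡-Reasoning
        A B C : Fin n → Bool
        A u = sum λ w → z< u w ∧ P u a b
        B u = sum λ w → z< u w ∧ P w a b
        C u = sum λ w → z< u w ∧ edge u w a b

  -- Walks

  infixr 5 _∷_ _++ʷ_
  data Walk : Fin n → Fin n → ℕ → Set where
    [] : ∀ {u} → Walk u u 0
    _∷_ : ∀ {u v w ℓ} → u ~ v → Walk v w ℓ → Walk u w (suc ℓ)

  -- Edges count mod 2: direction is forgotten and an edge walked twice disappears.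
  χ : ∀ {u w ℓ} → Walk u w ℓ → Chain n
  χ [] = 0ᶜ
  χ (_∷_ {u} {v} _ ω) = edge u v ⊞ χ ω

  _++ʷ_ : ∀ {u v w k ℓ} → Walk u v k → Walk v w ℓ → Walk u w (k + ℓ)
  [] ++ʷ ω′ = ω′
  (α ∷ ω) ++ʷ ω′ = α ∷ (ω ++ʷ ω′)

  χ-++ : ∀ {u v w k ℓ} (ω : Walk u v k) (ω′ : Walk v w ℓ) → χ (ω ++ʷ ω′) ≐ (χ ω ⊞ χ ω′)
  χ-++ [] ω′ a b = refl
  χ-++ (_∷_ {u} {v} α ω) ω′ a b =
    trans (cong (edge u v a b xor_) (χ-++ ω ω′ a b)) (sym (Bool.xor-assoc (edge u v a b) _ _))

  snoc : ∀ {u v w ℓ} → Walk u v ℓ → v ~ w → Walk u w (suc ℓ)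
  snoc [] β = β ∷ []
  snoc (α ∷ ω) β = α ∷ snoc ω β

  χ-snoc : ∀ {u v w ℓ} (ω : Walk u v ℓ) (β : v ~ w) → χ (snoc ω β) ≐ (χ ω ⊞ edge v w)
  χ-snoc [] β a b = Bool.xor-identityʳ _
  χ-snoc (_∷_ {u} {v} α ω) β a b =
    trans (cong (edge u v a b xor_) (χ-snoc ω β a b)) (sym (Bool.xor-assoc (edge u v a b) _ _))

  rev : ∀ {u w ℓ} → Walk u w ℓ → Walk w u ℓ
  rev [] = []
  rev (α ∷ ω) = snoc (rev ω) (~-sym α)

  χ-rev : ∀ {u w ℓ} (ω : Walk u w ℓ) → χ (rev ω) ≐ χ ω
  χ-rev [] a b = refl
  χ-rev (_∷_ {u} {v} α ω) a b = trans (χ-snoc (rev ω) (~-sym α) a b)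
    (trans (cong₂ _xor_ (χ-rev ω a b) (edge-sym v u a b)) (Bool.xor-comm (χ ω a b) _))

  -- Past its end a walk stays at its last vertex.
  at : ∀ {u w ℓ} → Walk u w ℓ → ℕ → Fin n
  at {u} _ zero = u
  at {u} [] (suc _) = u
  at (_ ∷ ω) (suc i) = at ω i

  at-end : ∀ {u w ℓ} (ω : Walk u w ℓ) → at ω ℓ ≡ w
  at-end [] = refl
  at-end (_ ∷ ω) = at-end ω

  at-~ : ∀ {u w ℓ} (ω : Walk u w ℓ) {i} → i < ℓ → at ω i ~ at ω (suc i)
  at-~ (α ∷ ω) {zero} _ = α
  at-~ (_ ∷ ω) {suc i} (s≤s i<ℓ) = at-~ ω i<ℓ

  take : ∀ {u w ℓ} (ω : Walk u w ℓ) {i} → i ≤ ℓ → Walk u (at ω i) i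
  take _ {zero} _ = []
  take (α ∷ ω) {suc i} (s≤s i≤ℓ) = α ∷ take ω i≤ℓ

  drop : ∀ {u w ℓ} (ω : Walk u w ℓ) i → Walk (at ω i) w (ℓ ∸ i)
  drop ω zero = ω
  drop [] (suc i) = []
  drop (_ ∷ ω) (suc i) = drop ω i

  χ-split : ∀ {u w ℓ} (ω : Walk u w ℓ) {i} (i≤ℓ : i ≤ ℓ) → χ ω ≐ (χ (take ω i≤ℓ) ⊞ χ (drop ω i))
  χ-split ω {zero} _ a b = refl
  χ-split (_∷_ {u} {v} _ ω) {suc i} (s≤s i≤ℓ) a b =
    trans (cong (edge u v a b xor_) (χ-split ω i≤ℓ a b)) (sym (Bool.xor-assoc (edge u v a b) _ _))

  at-drop : ∀ {u w ℓ} (ω : Walk u w ℓ) i j → at (drop ω i) j ≡ at ω (i + j)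
  at-drop ω zero j = refl
  at-drop [] (suc i) zero = refl
  at-drop [] (suc i) (suc j) = refl
  at-drop (_ ∷ ω) (suc i) j = at-drop ω i j

  -- Exhaustive search over the first step. `Q` is arbitrary so that the edge already walked can be
  -- absorbed into the predicate for the remaining walk.
  search : ∀ ℓ u w {Q : Chain n → Set} → (∀ c → Dec (Q c)) → Dec (Σ (Walk u w ℓ) (Q ∘ χ))
  search zero u w Q? with u ≟ w
  ... | yes refl = map′ ([] ,_) (λ { ([] , q) → q }) (Q? 0ᶜ)
  ... | no u≢w = no λ { ([] , _) → u≢w refl }
  search (suc ℓ) u w Q? = map′
    (λ (v , α , ω , q) → (α ∷ ω) , q)
    (λ { ((_∷_ {v = v} α ω) , q) → v , α , ω , q })
    (any? λ v → u ~? v ×-dec search ℓ v w (λ c → Q? (edge u v ⊞ c)))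

  fromStar : ∀ {u w} → Star _~_ u w → ∃[ ℓ ] Walk u w ℓ
  fromStar ε = 0 , []
  fromStar (α ◅ αs) = let (ℓ , ω) = fromStar αs in suc ℓ , α ∷ ω

  opaque
    path : ∀ u w → Walk u w (proj₁ (fromStar (connected u w)))
    path u w = proj₂ (fromStar (connected u w))

  -- Orientability

  adj : Chain n
  adj u v = does (u ~? v)

  -- The mod 2 cycle of edges across which the listed orientations of the two faces disagree.
  flips : Chain n
  flips a b = adj a b xor sum (λ i → arc i a b)

  opaque
    ∂ᶠ-nonadjacent : ∀ {a b} → ¬ a ~ b → ∀ i → ∂ᶠ i a b ≡ false
    ∂ᶠ-nonadjacent {a} {b} ¬a~b i = ≢true⇒false λ h → ¬a~b
      ((λ { refl → contradiction (trans (sym h) (∂ᶠ-irrefl i a)) λ () }) , i , ∂ᶠ-∈ i h)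

    arc-nonadjacent : ∀ {a b} → ¬ a ~ b → ∀ i → arc i a b ≡ false
    arc-nonadjacent ¬a~b i = ≢true⇒false λ h → ¬a~b (arc-≢ i h , i , arc-∈ i h)

    flips-nonadjacent : ∀ {a b} → ¬ a ~ b → flips a b ≡ false
    flips-nonadjacent {a} {b} ¬a~b = cong₂ _xor_ (dec-false (a ~? b) ¬a~b)
      (sum-false (λ i → arc i a b) (arc-nonadjacent ¬a~b))

    flips-irrefl : ∀ a → flips a a ≡ false
    flips-irrefl a = flips-nonadjacent λ (a≢a , _) → a≢a refl

    adj-sym : ∀ a b → adj a b ≡ adj b a
    adj-sym a b with b ~? a
    ... | yes p = dec-true (a ~? b) (~-sym p)
    ... | no ¬p = dec-false (a ~? b) (¬p ∘ ~-sym)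

    sum-faces : ∀ a b → sum (λ i → ∂ᶠ i a b) ≡ false
    sum-faces a b with a ~? b
    ... | yes p = let (i , j , _ , spec) = two-faces p in sum-pair {i = i} {j} (λ _ → true) (λ k → ∂ᶠ k a b) spec
    ... | no ¬p = sum-false (λ i → ∂ᶠ i a b) (∂ᶠ-nonadjacent ¬p)

    -- By `∂ᶠ-arc` the two arc sums add up to the boundary of the set of all faces, which vanishes
    -- because every edge lies on two of them.
    flips-sym : ∀ a b → flips a b ≡ flips b a
    flips-sym a b = cong₂ _xor_ (adj-sym a b) (xor-false
      (trans (sym (𝔽₂.∑-distrib-+ (λ i → arc i a b) (λ i → arc i b a)))
        (trans (𝔽₂.sum-cong-≗ λ i → sym (∂ᶠ-arc i a b)) (sum-faces a b))))

    degree-adj : ∀ a b → ℕΣ.sum (λ i → [ ∂ᶠ i a b ]ᵇ) ≡ 2 * [ adj a b ]ᵇ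
    degree-adj a b with a ~? b
    ... | yes p = let (i , j , i≢j , spec) = two-faces p in ℕsum-pair (λ k → ∂ᶠ k a b) i≢j spec
    ... | no ¬p = ℕsum-zero (λ i → [ ∂ᶠ i a b ]ᵇ) λ i → cong [_]ᵇ (∂ᶠ-nonadjacent ¬p i)

    -- Each edge at a lies on two faces and each face at a has two edges at a.
    degree≡faces : ∀ a → ℕΣ.sum (λ b → [ adj a b ]ᵇ) ≡ ℕΣ.sum (λ i → [ member i a ]ᵇ)
    degree≡faces a = *-cancelˡ-≡ _ _ 2 (begin
      2 * ℕΣ.sum (λ b → [ adj a b ]ᵇ)
        ≡⟨ ℕΣ.*-distribˡ-sum 2 (λ b → [ adj a b ]ᵇ) ⟩
      ℕΣ.sum (λ b → 2 * [ adj a b ]ᵇ)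
        ≡⟨ ℕΣ.sum-cong-≗ (degree-adj a) ⟨
      ℕΣ.sum (λ b → ℕΣ.sum (λ i → [ ∂ᶠ i a b ]ᵇ))
        ≡⟨ ℕΣ.∑-comm (λ b i → [ ∂ᶠ i a b ]ᵇ) ⟩
      ℕΣ.sum (λ i → ℕΣ.sum (λ b → [ ∂ᶠ i a b ]ᵇ))
        ≡⟨ ℕΣ.sum-cong-≗ (λ i → ∂ᶠ-degree i a) ⟩
      ℕΣ.sum (λ i → 2 * [ member i a ]ᵇ)
        ≡⟨ ℕΣ.*-distribˡ-sum 2 (λ i → [ member i a ]ᵇ) ⟨
      2 * ℕΣ.sum (λ i → [ member i a ]ᵇ) ∎)
      where open ≡-Reasoning

    -- The row of `adj` counts the edges at `a`, and the arcs leaving `a` count the faces there, one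
    -- arc per face. The two numbers agree by `degree≡faces`.
    flips-closed : ∀ a → sum (flips a) ≡ false
    flips-closed a = begin
      sum (flips a)
        ≡⟨ 𝔽₂.∑-distrib-+ (adj a) (λ b → sum λ i → arc i a b) ⟩
      sum (adj a) xor sum (λ b → sum λ i → arc i a b)
        ≡⟨ cong (sum (adj a) xor_) (trans (𝔽₂.∑-comm (λ b i → arc i a b)) (𝔽₂.sum-cong-≗ λ i → sum-arc i a)) ⟩
      sum (adj a) xor sum (λ i → member i a)
        ≡⟨ cong (_xor sum (λ i → member i a)) (trans (sym (parity-sum (adj a)))
             (trans (cong parity (degree≡faces a)) (parity-sum (λ i → member i a)))) ⟩
      sum (λ i → member i a) xor sum (λ i → member i a)
        ≡⟨ Bool.xor-same (sum (λ i → member i a)) ⟩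
      false ∎
      where open ≡-Reasoning

    -- For `false` the listed arc runs from `y` to `x`, so by `∂ᶠ-arc` it does not run from `x` to
    -- `y` as well.
    dir⇒∈ : ∀ b i {x y} → DirEdge face b i x y → (x ∈ i × y ∈ i) × x ≢ y × arc i x y ≡ b
    dir⇒∈ true i d = let h = dir⇒arc i d in arc-∈ i h , arc-≢ i h , h
    dir⇒∈ false i {x} {y} d = (x∈ , y∈) , x≢y , xor-cancel (trans (sym (∂ᶠ-arc i x y)) (∂ᶠ-edge i x∈ y∈ x≢y)) h
      where
      swapped : DirEdge face false i x y → DirEdge face true i y x
      swapped (inj₁ (p , q)) = inj₁ (q , p)
      swapped (inj₂ (inj₁ (p , q))) = inj₂ (inj₁ (q , p))
      swapped (inj₂ (inj₂ (p , q))) = inj₂ (inj₂ (q , p))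
      h : arc i y x ≡ true
      h = dir⇒arc i (swapped d)
      x∈ : x ∈ i
      x∈ = proj₂ (arc-∈ i h)
      y∈ : y ∈ i
      y∈ = proj₁ (arc-∈ i h)
      x≢y : x ≢ y
      x≢y = arc-≢ i h ∘ sym
      xor-cancel : ∀ {a b} → a xor b ≡ true → b ≡ true → a ≡ false
      xor-cancel {false} _ _ = refl
      xor-cancel {true} {false} _ ()

    sum-arcs : ∀ {x y i j} → i ≢ j → x ≢ y → x ∈ i → y ∈ i → x ∈ j → y ∈ j →
      sum (λ k → arc k x y) ≡ arc i x y xor arc j x y
    sum-arcs {x} {y} {i} {j} i≢j x≢y x∈i y∈i x∈j y∈j = trans (𝔽₂.sum-cong-≗ absorb)
      (sum-pair {i = i} {j} (λ k → arc k x y) (λ k → ∂ᶠ k x y) (edge-faces i≢j x≢y x∈i y∈i x∈j y∈j))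
      where
      -- An arc is a side of its face, so the extra factor changes nothing and gives the sum the
      -- form of `sum-pair`.
      absorb : ∀ k → arc k x y ≡ arc k x y ∧ ∂ᶠ k x y
      absorb k with arc k x y in h
      ... | false = refl
      ... | true = let (x∈ , y∈) = arc-∈ k h in sym (∂ᶠ-edge k x∈ y∈ x≢y)

    -- The bounding set is itself the orientation: faces outside it are reversed. If two faces ran
    -- along an edge in the same direction, comparing `flips` and `∂ S` on that edge would equate
    -- `S i xor S j` with its negation.
    flips-bounds⇒orientable : Bounds flips → Orientable face
    flips-bounds⇒orientable (S , flips≐) = S , coherent
      where
      coherent : CoherentOrientation face S
      coherent i j x y d d′ with i ≟ j
      ... | yes p = p
      ... | no i≢j = let ((x∈i , y∈i) , x≢y , p) = dir⇒∈ (S i) i d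
                         ((x∈j , y∈j) , _ , q) = dir⇒∈ (S j) j d′ in
        ⊥-elim (Bool.not-¬ {S i xor S j} refl (begin
          S i xor S j
            ≡⟨ ∂-edge S i≢j x≢y x∈i y∈i x∈j y∈j ⟨
          ∂ S x y
            ≡⟨ flips≐ x y ⟨
          adj x y xor sum (λ k → arc k x y)
            ≡⟨ cong₂ _xor_ (dec-true (x ~? y) (x≢y , i , x∈i , y∈i))
                 (trans (sum-arcs i≢j x≢y x∈i y∈i x∈j y∈j) (cong₂ _xor_ p q)) ⟩
          not (S i xor S j) ∎))
        where open ≡-Reasoning

    -- The candidates run from `v` to one end of an edge, across it and back. If all of them
    -- bounded, then `cycle-bounds` would make `flips` bound.
    nonbounding-walk : Fin n → ¬ Orientable face → ∃[ ℓ ] ∃[ u ] Σ (Walk u u ℓ) λ ω → ¬ Bounds (χ ω)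
    nonbounding-walk v ¬orientable
      with any? (λ u → any? λ w → u ~? w ×-dec ¬? (bounds? (χ (path v u) ⊞ edge u w ⊞ χ (path v w))))
    ... | yes (u , w , u~w , ¬bounds) = _ , v , (path v u ++ʷ u~w ∷ rev (path v w)) , λ h →
      ¬bounds (Bounds-≐ (λ a b → trans (Bool.xor-assoc (χ (path v u) a b) _ _)
        (sym (trans (χ-++ (path v u) (u~w ∷ rev (path v w)) a b)
          (cong (χ (path v u) a b xor_) (cong (edge u w a b xor_) (χ-rev (path v w) a b)))))) h)
    ... | no ¬any = ⊥-elim (¬orientable (flips-bounds⇒orientable
      (cycle-bounds flips (λ u → χ (path v u)) flips-irrefl flips-sym flips-closed λ u w h →
        decidable-stable (bounds? _) λ ¬bounds → ¬any (u , w ,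
          decidable-stable (u ~? w) (λ ¬u~w → contradiction (trans (sym h) (flips-nonadjacent ¬u~w)) λ ()) , ¬bounds))))

  -- Homotopy and homology

  -- Homotopy moves act on plain vertex lists, with no adjacency built in; hence a second version of
  -- `χ`.
  χᴸ : List (Fin n) → Chain n
  χᴸ [] = 0ᶜ
  χᴸ (_ ∷ []) = 0ᶜ
  χᴸ (u ∷ w ∷ q) = edge u w ⊞ χᴸ (w ∷ q)

  χᴸ-++ : ∀ p u q → χᴸ (p ++ u ∷ q) ≐ (χᴸ (p ++ u ∷ []) ⊞ χᴸ (u ∷ q))
  χᴸ-++ [] u q a b = refl
  χᴸ-++ (x ∷ []) u q a b = cong (_xor χᴸ (u ∷ q) a b) (sym (Bool.xor-identityʳ (edge x u a b)))
  χᴸ-++ (x ∷ y ∷ p) u q a b =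
    trans (cong (edge x y a b xor_) (χᴸ-++ (y ∷ p) u q a b)) (sym (Bool.xor-assoc (edge x y a b) _ _))

  opaque
    -- A backtrack uses its edge twice, which cancels; a push across a face changes the chain by the
    -- boundary of that face.
    step-bounds : ∀ {xs ys} → HStep face xs ys → Bounds (χᴸ xs ⊞ χᴸ ys)
    step-bounds (backtrack p q u v _) = Bounds-≐ (λ a b →
      trans (cong₂ _xor_ (χᴸ-++ p u (v ∷ u ∷ q) a b) (χᴸ-++ p u q a b))
        (trans (cong (λ e → (χᴸ (p ++ u ∷ []) a b xor (edge u v a b xor (e xor χᴸ (u ∷ q) a b)))
                    xor (χᴸ (p ++ u ∷ []) a b xor χᴸ (u ∷ q) a b)) (edge-sym v u a b))
          (xor-solve 3 (λ x e y → (x :+ (e :+ (e :+ y))) :+ (x :+ y) := bit false) refl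
            (χᴸ (p ++ u ∷ []) a b) (edge u v a b) (χᴸ (u ∷ q) a b)))) Bounds-0
    step-bounds (across p q u v w i u∈ v∈ w∈ u≢v v≢w u≢w) = Bounds-≐ (λ a b →
      trans (cong₂ _xor_ (χᴸ-++ p u (w ∷ q) a b) (χᴸ-++ p u (v ∷ w ∷ q) a b))
        (trans (trans (cong (λ e → (χᴸ (p ++ u ∷ []) a b xor (e xor χᴸ (w ∷ q) a b))
                    xor (χᴸ (p ++ u ∷ []) a b xor (edge u v a b xor (edge v w a b xor χᴸ (w ∷ q) a b))))
                    (edge-sym u w a b))
          (xor-solve 5 (λ x e f g y → (x :+ (e :+ y)) :+ (x :+ (f :+ (g :+ y))) := f :+ g :+ e) refl
            (χᴸ (p ++ u ∷ []) a b) (edge w u a b) (edge u v a b) (edge v w a b) (χᴸ (w ∷ q) a b)))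
          (∂ᶠ-unique i u∈ v∈ w∈ u≢v v≢w u≢w a b))) (Bounds-face i)

    contractible⇒bounds : ∀ {v xs} → ContractibleClosedWalk face v xs → Bounds (χᴸ xs)
    contractible⇒bounds ε = Bounds-0
    contractible⇒bounds (_◅_ {xs} {ys} (fwd s) h) = Bounds-⊞ (step-bounds s) (contractible⇒bounds h) λ a b →
      xor-solve 2 (λ x y → x := (x :+ y) :+ y) refl (χᴸ xs a b) (χᴸ ys a b)
    contractible⇒bounds (_◅_ {xs} {ys} (bwd s) h) = Bounds-⊞ (step-bounds s) (contractible⇒bounds h) λ a b →
      xor-solve 2 (λ x y → x := (y :+ x) :+ y) refl (χᴸ xs a b) (χᴸ ys a b)

    χᴸ-walk : ∀ {u w ℓ} (ω : Walk u w ℓ) → χᴸ (applyUpTo (at ω) (suc ℓ)) ≐ χ ω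
    χᴸ-walk [] a b = refl
    χᴸ-walk (_∷_ {u} {v} α ω) a b = cong (edge u v a b xor_) (χᴸ-walk ω a b)

  -- Separating sets of vertices

  ∂-nonadjacent : ∀ S {a b} → ¬ a ~ b → ∂ S a b ≡ false
  ∂-nonadjacent S {a} {b} ¬a~b = sum-false (λ i → S i ∧ ∂ᶠ i a b) λ i →
    trans (cong (S i ∧_) (∂ᶠ-nonadjacent ¬a~b i)) (Bool.∧-zeroʳ (S i))

  -- By `linkConn` the faces at `v` are chained through edges at `v`, so comparing `f` across each
  -- of these edges suffices.
  around : ∀ (f : Fin m → Bool) v →
    (∀ {i j u} → i ≢ j → v ≢ u → v ∈ i → u ∈ i → v ∈ j → u ∈ j → f i ≡ f j) →
    ∀ {i j} → v ∈ i → v ∈ j → f i ≡ f j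
  around f v step v∈i v∈j = go (linkConn v _ _ v∈i v∈j)
    where
    go : ∀ {i j} → Star (LinkAdj face v) i j → f i ≡ f j
    go ε = refl
    go (_◅_ {i} {j} (v∈i , v∈j , u , u≢v , u∈i , u∈j) rest) with i ≟ j
    ... | yes refl = go rest
    ... | no i≢j = trans (step i≢j (u≢v ∘ sym) v∈i u∈i v∈j u∈j) (go rest)

  -- The part of the boundary of the band of faces meeting both I and K that runs inside K bounds a set S of faces.
  -- S is constant around a vertex outside K, while around a vertex of K it changes exactly where the band ends.
  module Separation {I K : Fin n → Set} (I? : Decidable I) (K? : Decidable K)
    (K-closed : ∀ {t u w} → K u → u ~ w → I t → t ~ w → ¬ I w → K w)
    (K-bounds : ∀ z → (∀ a → z a a ≡ false) → (∀ a b → z a b ≡ z b a) → (∀ a → sum (z a) ≡ false) →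
      (∀ a b → z a b ≡ true → a ~ b × K a × K b) → Bounds z) where

    Band : Fin m → Set
    Band i = (∃[ a ] (a ∈ i × K a)) × (∃[ t ] (t ∈ i × I t))

    opaque
      band? : ∀ i → Dec (Band i)
      band? i = any? (λ a → a ∈? i ×-dec K? a) ×-dec any? (λ t → t ∈? i ×-dec I? t)

    band : Fin m → Bool
    band i = does (band? i)

    rim : Chain n
    rim a b = (does (K? a) ∧ does (K? b)) ∧ ∂ band a b

    opaque
      -- If `w` is in `I`, both faces on the edge are in the band. If not, neither is: a vertex of
      -- `I` on one of them would be adjacent to `w`, and `K-closed` would put `w` in `K`.
      ∂-band-leaving : ∀ {u w} → K u → ¬ K w → ∂ band u w ≡ false
      ∂-band-leaving {u} {w} ku ¬kw with u ~? w
      ... | no ¬u~w = ∂-nonadjacent band ¬u~w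
      ... | yes u~w with edgeTwo u w u~w
      ... | i , j , i≢j , (u∈i , w∈i) , (u∈j , w∈j) , _ with I? w
      ... | yes iw = trans (∂-edge band i≢j (proj₁ u~w) u∈i w∈i u∈j w∈j) (cong₂ _xor_
              (dec-true (band? i) ((u , u∈i , ku) , (w , w∈i , iw)))
              (dec-true (band? j) ((u , u∈j , ku) , (w , w∈j , iw))))
      ... | no ¬iw = trans (∂-edge band i≢j (proj₁ u~w) u∈i w∈i u∈j w∈j) (cong₂ _xor_
              (dec-false (band? i) (unbanded w∈i)) (dec-false (band? j) (unbanded w∈j)))
        where
        unbanded : ∀ {i} → w ∈ i → ¬ Band i
        unbanded {i} w∈i (_ , t , t∈i , it) =
          ¬kw (K-closed ku u~w it ((λ { refl → ¬iw it }) , i , t∈i , w∈i) ¬iw)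

      rim-K : ∀ {u} → K u → ∀ w → rim u w ≡ ∂ band u w
      rim-K {u} ku w rewrite dec-true (K? u) ku with K? w
      ... | yes _ = refl
      ... | no ¬kw = sym (∂-band-leaving ku ¬kw)

      rim-¬K : ∀ {u} → ¬ K u → ∀ w → rim u w ≡ false
      rim-¬K {u} ¬ku w rewrite dec-false (K? u) ¬ku = refl

      rim-true : ∀ a b → rim a b ≡ true → a ~ b × K a × K b
      rim-true a b h with K? a | K? b | a ~? b
      ... | yes ka | yes kb | yes a~b = a~b , ka , kb
      ... | yes ka | yes kb | no ¬a~b = contradiction (trans (sym h) (∂-nonadjacent band ¬a~b)) λ ()
      ... | yes ka | no _ | _ = contradiction h λ ()
      ... | no _ | _ | _ = contradiction h λ ()

      rim-closed : ∀ a → sum (rim a) ≡ false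
      rim-closed a with K? a
      ... | no ¬ka = sum-false {n} (λ _ → false) λ _ → refl
      ... | yes ka = trans (𝔽₂.sum-cong-≗ λ b → row b) (sum-∂ band a)
        where
        row : ∀ b → (true ∧ does (K? b)) ∧ ∂ band a b ≡ ∂ band a b
        row b with K? b
        ... | yes _ = refl
        ... | no ¬kb = sym (∂-band-leaving ka ¬kb)

      rim-bounds : Bounds rim
      rim-bounds = K-bounds rim
        (λ a → trans (cong ((does (K? a) ∧ does (K? a)) ∧_) (∂-irrefl band a)) (Bool.∧-zeroʳ _))
        (λ a b → cong₂ _∧_ (Bool.∧-comm (does (K? a)) (does (K? b))) (∂-flip band a b))
        rim-closed rim-true

    S : Fin m → Bool
    S = proj₁ rim-bounds

    -- For `u` outside `K` the choice of the face is immaterial by `S-¬K`.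
    colour : Fin n → Bool
    colour u = S (proj₁ (covered u))

    opaque
      S-edge : ∀ {u v i j} → i ≢ j → u ≢ v → u ∈ i → v ∈ i → u ∈ j → v ∈ j → rim u v ≡ S i xor S j
      S-edge {u} {v} i≢j u≢v u∈i v∈i u∈j v∈j =
        trans (proj₂ rim-bounds u v) (∂-edge S i≢j u≢v u∈i v∈i u∈j v∈j)

      S-¬K : ∀ {u} → ¬ K u → ∀ {i} → u ∈ i → S i ≡ colour u
      S-¬K {u} ¬ku u∈i = around S u (λ {_} {_} {v} i≢j u≢v u∈i v∈i u∈j v∈j →
        xor-false (trans (sym (S-edge i≢j u≢v u∈i v∈i u∈j v∈j)) (rim-¬K ¬ku v))) u∈i (proj₂ (covered u))

      colour-~ : ∀ {u w} → ¬ K u → ¬ K w → u ~ w → colour u ≡ colour w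
      colour-~ ¬ku ¬kw (_ , i , u∈i , w∈i) = trans (sym (S-¬K ¬ku u∈i)) (S-¬K ¬kw w∈i)

      -- At `x` the sets `S` and `band` have the same boundary edges by `rim-K`, so their sum has
      -- none there.
      S-K : ∀ {x} → K x → ∀ {i j} → x ∈ i → x ∈ j → S i xor band i ≡ S j xor band j
      S-K {x} kx = around (λ i → S i xor band i) x λ {i} {j} {v} i≢j x≢v x∈i v∈i x∈j v∈j → xor-false (trans
        (xor-solve 4 (λ a b c d → (a :+ b) :+ (c :+ d) := (a :+ c) :+ (b :+ d)) refl (S i) (band i) (S j) (band j))
        (trans (cong₂ _xor_
            (trans (sym (S-edge i≢j x≢v x∈i v∈i x∈j v∈j)) (rim-K kx v))
            (sym (∂-edge band i≢j x≢v x∈i v∈i x∈j v∈j)))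
          (Bool.xor-same (∂ band x v))))

      -- A face on `a` and `x` is in the band; a face on `x` and `b` is not, since no vertex of `I`
      -- equals `b` or is adjacent to it. By `S-K` the set `S` changes along with the band.
      colour-cross : ∀ {x a b} → K x → ¬ K a → I a → a ~ x → ¬ K b → ¬ I b → (∀ {t} → I t → ¬ t ~ b) → x ~ b →
        colour a ≢ colour b
      colour-cross {x} {a} {b} kx ¬ka ia (_ , i , a∈i , x∈i) ¬kb ¬ib far (_ , j , x∈j , b∈j) same = absurd (begin
        not (colour a)
          ≡⟨ Bool.xor-comm true (colour a) ⟩
        colour a xor true
          ≡⟨ cong₂ _xor_ (S-¬K ¬ka a∈i) (dec-true (band? i) ((x , x∈i , kx) , (a , a∈i , ia))) ⟨
        S i xor band i
          ≡⟨ S-K kx x∈i x∈j ⟩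
        S j xor band j
          ≡⟨ cong₂ _xor_ (S-¬K ¬kb b∈j) (dec-false (band? j) unbanded) ⟩
        colour b xor false
          ≡⟨ Bool.xor-identityʳ _ ⟩
        colour b
          ≡⟨ same ⟨
        colour a ∎)
        where
        open ≡-Reasoning
        absurd : ∀ {c} → not c ≢ c
        absurd {true} ()
        absurd {false} ()
        unbanded : ¬ Band j
        unbanded (_ , t , t∈j , it) = far it ((λ { refl → ¬ib it }) , j , t∈j , b∈j)

  -- A shortest non-bounding closed walk, of length η + 2s with η ≤ 1, cut into an edge or vertex `link` and two arms
  -- of length s. Balls are taken around the ends of `link`.
  module Systole {p q z : Fin n} {η s : ℕ} (η≤1 : η ≤ 1)
    (short : ∀ {u ℓ} → ℓ < η + (s + s) → (ω : Walk u u ℓ) → Bounds (χ ω))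
    (link : Walk p q η) (X : Walk q z s) (Y : Walk p z s)
    (nonbounding : ¬ Bounds (χ link ⊞ χ X ⊞ χ Y)) where

    root : Bool → Fin n
    root false = p
    root true = q

    -- Prefixing the link to walks from `q` makes every `ξ` the chain of a walk from `p`.
    κ : Bool → Chain n
    κ false = 0ᶜ
    κ true = χ link

    RootWalk : Fin n → ℕ → Set
    RootWalk u ℓ = Σ Bool λ b → Walk (root b) u ℓ

    ξ : ∀ {u ℓ} → RootWalk u ℓ → Chain n
    ξ (b , ω) = κ b ⊞ χ ω

    opaque
      -- Out along one walk and back along the other, passing through the link only if the roots
      -- differ, is a closed walk of length at most η + k + ℓ < η + 2s.
      two-roots : ∀ {u k ℓ} (V : RootWalk u k) (W : RootWalk u ℓ) → k + ℓ < s + s → Bounds (ξ V ⊞ ξ W)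
      two-roots (false , V) (false , W) h = Bounds-≐
        (λ a b → sym (trans (χ-++ V (rev W) a b) (cong (χ V a b xor_) (χ-rev W a b))))
        (short (<-≤-trans h (m≤n+m (s + s) η)) (V ++ʷ rev W))
      two-roots (true , V) (true , W) h = Bounds-≐
        (λ a b → trans
          (xor-solve 3 (λ l v w → (l :+ v) :+ (l :+ w) := v :+ w) refl (χ link a b) (χ V a b) (χ W a b))
          (sym (trans (χ-++ V (rev W) a b) (cong (χ V a b xor_) (χ-rev W a b)))))
        (short (<-≤-trans h (m≤n+m (s + s) η)) (V ++ʷ rev W))
      two-roots (true , V) (false , W) h = Bounds-≐
        (λ a b → trans (Bool.xor-assoc (χ link a b) _ _)
          (sym (trans (χ-++ link (V ++ʷ rev W) a b) (cong (χ link a b xor_)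
            (trans (χ-++ V (rev W) a b) (cong (χ V a b xor_) (χ-rev W a b)))))))
        (short (+-monoʳ-< η h) (link ++ʷ V ++ʷ rev W))
      two-roots {k = k} {ℓ} (false , V) (true , W) h = Bounds-≐
        (λ a b → trans
          (xor-solve 3 (λ l v w → v :+ (l :+ w) := l :+ (w :+ v)) refl (χ link a b) (χ V a b) (χ W a b))
          (sym (trans (χ-++ link (W ++ʷ rev V) a b) (cong (χ link a b xor_)
            (trans (χ-++ W (rev V) a b) (cong (χ W a b xor_) (χ-rev V a b)))))))
        (short (+-monoʳ-< η (subst (_< s + s) (+-comm k ℓ) h)) (link ++ʷ W ++ʷ rev V))

      -- `V` and `V′` are the two ways from the link to `u` along the closed walk. A walk `W`
      -- shorter than `i` would close up with each of them to a bounding walk, and the sum of these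
      -- two is the non-bounding chain.
      isometric : ∀ {u i ℓ} → i ≤ s → (V : RootWalk u i) (V′ : RootWalk u (s + (s ∸ i))) →
        (χ link ⊞ χ X ⊞ χ Y) ≐ (ξ V ⊞ ξ V′) → RootWalk u ℓ → i ≤ ℓ
      isometric {u} {i} {ℓ} i≤s V V′ split W = ≮⇒≥ λ ℓ<i → nonbounding (Bounds-⊞
        (two-roots V W (<-≤-trans (+-monoʳ-< i ℓ<i) (+-mono-≤ i≤s i≤s)))
        (two-roots V′ W (<-≤-trans (+-monoʳ-< (s + (s ∸ i)) ℓ<i)
          (≤-reflexive (trans (+-assoc s (s ∸ i) i) (cong (s +_) (m∸n+n≡m i≤s))))))
        λ a b → trans (split a b)
          (xor-solve 3 (λ v v′ w → v :+ v′ := (v :+ w) :+ (v′ :+ w)) refl (ξ V a b) (ξ V′ a b) (ξ W a b)))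

      X-isometric : ∀ {i ℓ} → i ≤ s → RootWalk (at X i) ℓ → i ≤ ℓ
      X-isometric {i} i≤s = isometric i≤s (true , take X i≤s) (false , Y ++ʷ rev (drop X i)) λ a b → trans
        (cong (λ x → (χ link a b xor x) xor χ Y a b) (χ-split X i≤s a b))
        (trans (xor-solve 4 (λ l t d y → l :+ (t :+ d) :+ y := (l :+ t) :+ (y :+ d)) refl
            (χ link a b) (χ (take X i≤s) a b) (χ (drop X i) a b) (χ Y a b))
          (cong ((χ link ⊞ χ (take X i≤s)) a b xor_) (sym (trans (χ-++ Y (rev (drop X i)) a b)
            (cong (χ Y a b xor_) (χ-rev (drop X i) a b))))))

      Y-isometric : ∀ {i ℓ} → i ≤ s → RootWalk (at Y i) ℓ → i ≤ ℓ
      Y-isometric {i} i≤s = isometric i≤s (false , take Y i≤s) (true , X ++ʷ rev (drop Y i)) λ a b → trans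
        (cong ((χ link a b xor χ X a b) xor_) (χ-split Y i≤s a b))
        (trans (xor-solve 4 (λ l t d x → l :+ x :+ (t :+ d) := t :+ (l :+ (x :+ d))) refl
            (χ link a b) (χ (take Y i≤s) a b) (χ (drop Y i) a b) (χ X a b))
          (cong (λ c → χ (take Y i≤s) a b xor (χ link a b xor c)) (sym (trans (χ-++ X (rev (drop Y i)) a b)
            (cong (χ X a b xor_) (χ-rev (drop Y i) a b))))))

    -- Balls and spheres around the link

    Ball : ℕ → Fin n → Set
    Ball zero u = u ≡ p ⊎ u ≡ q
    Ball (suc r) u = Ball r u ⊎ ∃[ w ] (Ball r w × w ~ u)

    Ball? : ∀ r → Decidable (Ball r)
    Ball? zero u = u ≟ p ⊎-dec u ≟ q
    Ball? (suc r) u = Ball? r u ⊎-dec any? λ w → Ball? r w ×-dec w ~? u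

    Ball-mono : ∀ {t r u} → t ≤ r → Ball t u → Ball r u
    Ball-mono {t} {r} t≤r b = go (≤⇒≤′ t≤r) b
      where
      go : ∀ {r u} → t ≤′ r → Ball t u → Ball r u
      go ≤′-refl b = b
      go (≤′-step h) b = inj₁ (go h b)

    Ball-walk : ∀ r {u} → Ball r u → ∃[ ℓ ] (ℓ ≤ r × RootWalk u ℓ)
    Ball-walk zero (inj₁ refl) = 0 , z≤n , false , []
    Ball-walk zero (inj₂ refl) = 0 , z≤n , true , []
    Ball-walk (suc r) (inj₁ b) = let (ℓ , ℓ≤r , W) = Ball-walk r b in ℓ , m≤n⇒m≤1+n ℓ≤r , W
    Ball-walk (suc r) (inj₂ (w , b , w~u)) =
      let (ℓ , ℓ≤r , c , W) = Ball-walk r b in suc ℓ , s≤s ℓ≤r , c , snoc W w~u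

    X-in : ∀ {i} → i ≤ s → Ball i (at X i)
    X-in {zero} _ = inj₂ refl
    X-in {suc i} i<s = inj₂ (at X i , X-in (<⇒≤ i<s) , at-~ X i<s)

    Y-in : ∀ {i} → i ≤ s → Ball i (at Y i)
    Y-in {zero} _ = inj₁ refl
    Y-in {suc i} i<s = inj₂ (at Y i , Y-in (<⇒≤ i<s) , at-~ Y i<s)

    X-out : ∀ {i t} → i ≤ s → t < i → ¬ Ball t (at X i)
    X-out {i} {t} i≤s t<i b = let (ℓ , ℓ≤t , W) = Ball-walk t b in
      <⇒≱ t<i (≤-trans (X-isometric i≤s W) ℓ≤t)

    Y-out : ∀ {i t} → i ≤ s → t < i → ¬ Ball t (at Y i)
    Y-out {i} {t} i≤s t<i b = let (ℓ , ℓ≤t , W) = Ball-walk t b in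
      <⇒≱ t<i (≤-trans (Y-isometric i≤s W) ℓ≤t)

    module Sphere (r′ : ℕ) (r<s : suc r′ < s) where

      r : ℕ
      r = suc r′

      r≤s : r ≤ s
      r≤s = <⇒≤ r<s

      x y : Fin n
      x = at X r
      y = at Y r

      OnSphere : Fin n → Set
      OnSphere u = Ball r u × ¬ Ball r′ u

      OnSphere? : Decidable OnSphere
      OnSphere? u = Ball? r u ×-dec ¬? (Ball? r′ u)

      x-on : OnSphere x
      x-on = X-in r≤s , X-out r≤s ≤-refl

      opaque
        -- A chosen short walk from the link to each vertex of the ball, to be used in
        -- `cycle-bounds`; outside the ball `0ᶜ` is only a default.
        P : Fin n → Chain n
        P u with Ball? r u
        ... | yes b = ξ (proj₂ (proj₂ (Ball-walk r b)))
        ... | no _ = 0ᶜ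

        P-walk : ∀ {u} → Ball r u → ∃[ ℓ ] (ℓ ≤ r × Σ (RootWalk u ℓ) λ W → P u ≡ ξ W)
        P-walk {u} b with Ball? r u
        ... | yes b′ = let (ℓ , ℓ≤r , W) = Ball-walk r b′ in ℓ , ℓ≤r , W , refl
        ... | no ¬b = contradiction b ¬b

      opaque
        -- The lengths add up to at most 2r + 1 < 2s. The bound `suc r` leaves room for the
        -- additional edge in `P-edge`.
        P-root : ∀ {u ℓ} → Ball r u → ℓ ≤ suc r → (V : RootWalk u ℓ) → Bounds (P u ⊞ ξ V)
        P-root b ℓ≤1+r V with P-walk b
        ... | k , k≤r , W , P≡ = Bounds-≐ (λ a b → cong (λ c → c a b xor ξ V a b) P≡)
          (two-roots W V (<-≤-trans (s≤s (+-mono-≤ k≤r ℓ≤1+r)) (+-mono-≤ r<s r<s)))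

        P-edge : ∀ {u w} → u ~ w → Ball r u → Ball r w → Bounds (P u ⊞ edge u w ⊞ P w)
        P-edge {u} {w} u~w bu bw with P-walk bu
        ... | k , k≤r , (c , W) , P≡ = Bounds-≐
          (λ a b → trans (cong (λ d → (d a b xor edge u w a b) xor P w a b) P≡)
            (trans (xor-solve 4 (λ k c e p → ((k :+ c) :+ e) :+ p := p :+ (k :+ (c :+ e))) refl
                (κ c a b) (χ W a b) (edge u w a b) (P w a b))
              (cong (λ d → P w a b xor (κ c a b xor d)) (sym (χ-snoc W u~w a b)))))
          (P-root bw (s≤s k≤r) (c , snoc W u~w))

        cycle-in-ball : ∀ c → (∀ a → c a a ≡ false) → (∀ a b → c a b ≡ c b a) → (∀ a → sum (c a) ≡ false) →
          (∀ a b → c a b ≡ true → a ~ b × Ball r a × Ball r b) → Bounds c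
        cycle-in-ball c irr symm closed inside = cycle-bounds c P irr symm closed λ u w h →
          let (u~w , bu , bw) = inside u w h in P-edge u~w bu bw

      -- Approximates the component of `x` in the sphere. The number of steps is kept so that it can
      -- bound the length of an arc and count vertices.
      Reach : ℕ → Fin n → Set
      Reach zero u = u ≡ x
      Reach (suc j) u = Reach j u ⊎ ∃[ w ] (Reach j w × w ~ u × OnSphere u)

      Reach? : ∀ j → Decidable (Reach j)
      Reach? zero u = u ≟ x
      Reach? (suc j) u = Reach? j u ⊎-dec any? λ w → Reach? j w ×-dec w ~? u ×-dec OnSphere? u

      Reach-x : ∀ j → Reach j x
      Reach-x zero = refl
      Reach-x (suc j) = inj₁ (Reach-x j)

      Reach-on : ∀ j {u} → Reach j u → OnSphere u
      Reach-on zero refl = x-on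
      Reach-on (suc j) (inj₁ h) = Reach-on j h
      Reach-on (suc j) (inj₂ (_ , _ , _ , on)) = on

      opaque
        -- Each step adds a bounding chain from `P-edge`, so the arc may be exchanged for the detour
        -- through the ball along `P x` and `P u`.
        Reach-walk : ∀ j {u} → Reach j u → ∃[ ℓ ] (ℓ ≤ j × Σ (Walk x u ℓ) λ α → Bounds (P x ⊞ χ α ⊞ P u))
        Reach-walk zero refl = 0 , z≤n , [] , Bounds-≐
          (λ a b → xor-solve 1 (λ c → (c :+ bit false) :+ c := bit false) refl (P x a b)) Bounds-0
        Reach-walk (suc j) (inj₁ h) = let (ℓ , ℓ≤j , α , bounds) = Reach-walk j h in ℓ , m≤n⇒m≤1+n ℓ≤j , α , bounds
        Reach-walk (suc j) {u} (inj₂ (w , h , w~u , on)) =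
          let (ℓ , ℓ≤j , α , bounds) = Reach-walk j h in
          suc ℓ , s≤s ℓ≤j , snoc α w~u ,
          Bounds-⊞ bounds (P-edge w~u (proj₁ (Reach-on j h)) (proj₁ on)) λ a b →
            trans (cong (λ d → (P x a b xor d) xor P u a b) (χ-snoc α w~u a b))
              (xor-solve 5 (λ px al e pu pw → (px :+ (al :+ e)) :+ pu := ((px :+ al) :+ pw) :+ ((pw :+ e) :+ pu)) refl
                (P x a b) (χ α a b) (edge w u a b) (P u a b) (P w a b))

        -- Replacing the part of the closed walk inside the ball by an arc of the sphere from x to y
        -- leaves a non-bounding closed walk.
        arc-length : ∀ j → Reach j y → r + r + η ≤ j
        arc-length j h = ≮⇒≥ λ j<2r+η →
          let (ℓ , ℓ≤j , α , Bα) = Reach-walk j h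
              BX = P-root (X-in r≤s) (n≤1+n r) (true , take X r≤s)
              BY = P-root (Y-in r≤s) (n≤1+n r) (false , take Y r≤s)
              Bω = short (closed-short (≤-<-trans ℓ≤j j<2r+η)) (α ++ʷ drop Y r ++ʷ rev (drop X r))
          in nonbounding (Bounds-⊞
            (Bounds-⊞ BX BY (λ _ _ → refl)) (Bounds-⊞ Bα Bω (λ _ _ → refl)) λ a b → trans
              (cong₂ (λ c d → (χ link a b xor c) xor d) (χ-split X r≤s a b) (χ-split Y r≤s a b))
              (trans (xor-solve 8 (λ l tx dx ty dy px py al →
                    (l :+ (tx :+ dx)) :+ (ty :+ dy) :=
                    ((px :+ (l :+ tx)) :+ (py :+ ty)) :+ (((px :+ al) :+ py) :+ (al :+ (dy :+ dx)))) refl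
                  (χ link a b) (χ (take X r≤s) a b) (χ (drop X r) a b) (χ (take Y r≤s) a b) (χ (drop Y r) a b)
                  (P x a b) (P y a b) (χ α a b))
                (cong (λ c → ((P x ⊞ (χ link ⊞ χ (take X r≤s))) ⊞ (P y ⊞ χ (take Y r≤s))) a b
                      xor (((P x ⊞ χ α) ⊞ P y) a b xor c))
                  (sym (trans (χ-++ α (drop Y r ++ʷ rev (drop X r)) a b) (cong (χ α a b xor_)
                    (trans (χ-++ (drop Y r) (rev (drop X r)) a b)
                      (cong (χ (drop Y r) a b xor_) (χ-rev (drop X r) a b)))))))))
          where
          -- The arc replaces the link and the first `r` edges of each arm, 2r + η edges in all.
          closed-short : ∀ {ℓ} → ℓ < r + r + η → ℓ + ((s ∸ r) + (s ∸ r)) < η + (s + s)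
          closed-short {ℓ} ℓ<2r+η = <-≤-trans (+-monoˡ-< ((s ∸ r) + (s ∸ r)) ℓ<2r+η) (≤-reflexive (trans
            (solve 3 (λ r η d → (r ⊕ r ⊕ η) ⊕ (d ⊕ d) ⊜ η ⊕ ((r ⊕ d) ⊕ (r ⊕ d))) refl r η (s ∸ r))
            (cong (λ t → η + (t + t)) (m+[n∸m]≡n r≤s))))
            where open +-*-Solver using (solve) renaming (_:+_ to _⊕_; _:=_ to _⊜_)

        -- A component without `y` can serve as `K` in `Separation`. From `at X r′` through the
        -- link, along `Y` to its end and back along `X` to `at X (suc r)`, the closed walk avoids
        -- it and keeps its colour; yet the remaining two edges cross it at `x`, which changes the
        -- colour.
        stable⇒y : ∀ j → (∀ {u} → Reach (suc j) u → Reach j u) → Reach j y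
        stable⇒y j stable = decidable-stable (Reach? j y) λ ¬y → colour-cross
            (Reach-x j) (inner ≤-refl) (X-in (<⇒≤ (<⇒≤ r<s))) (at-~ X (<⇒≤ r<s))
            (X-outer ≤-refl r<s) (X-out r<s (m≤n⇒m≤1+n ≤-refl))
            (λ t∈ t~b → X-out r<s ≤-refl (inj₂ (_ , t∈ , t~b))) (at-~ X r<s)
            (begin
              colour (at X r′)
                ≡⟨ along (at X) 0 r′ (λ _ i<r′ →
                     colour-~ (inner (<⇒≤ i<r′)) (inner i<r′) (at-~ X (<-trans i<r′ (<⇒≤ r<s)))) ⟨
              colour q
                ≡⟨ linked link η≤1 (not-ball-K (Ball-mono z≤n (inj₁ refl))) (not-ball-K (Ball-mono z≤n (inj₂ refl))) ⟨
              colour p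
                ≡⟨ along (at Y) 0 s (λ _ i<s → colour-~ (Y-avoids ¬y (<⇒≤ i<s)) (Y-avoids ¬y i<s) (at-~ Y i<s)) ⟩
              colour (at Y s)
                ≡⟨ cong colour (trans (at-end Y) (sym (trans (cong (at X) (m+[n∸m]≡n r<s)) (at-end X)))) ⟩
              colour (at X (suc r + (s ∸ suc r)))
                ≡⟨ along (at X) (suc r) (s ∸ suc r) (λ {i} r<i i<s → let i<s = subst (i <_) (m+[n∸m]≡n r<s) i<s in
                     colour-~ (X-outer r<i (<⇒≤ i<s)) (X-outer (m≤n⇒m≤1+n r<i) i<s) (at-~ X i<s)) ⟨
              colour (at X (suc r)) ∎)
          where
          open ≡-Reasoning
          not-ball-K : ∀ {u} → Ball r′ u → ¬ Reach j u
          not-ball-K b h = proj₂ (Reach-on j h) b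
          inner : ∀ {i} → i ≤ r′ → ¬ Reach j (at X i)
          inner i≤r′ = not-ball-K (Ball-mono i≤r′ (X-in (≤-trans i≤r′ (<⇒≤ (<⇒≤ r<s)))))
          X-outer : ∀ {i} → r < i → i ≤ s → ¬ Reach j (at X i)
          X-outer r<i i≤s h = X-out i≤s r<i (proj₁ (Reach-on j h))
          Y-avoids : ¬ Reach j y → ∀ {i} → i ≤ s → ¬ Reach j (at Y i)
          Y-avoids ¬y {i} i≤s h with <-cmpᴺ i r
          ... | tri< (s≤s i≤r′) _ _ = not-ball-K (Ball-mono i≤r′ (Y-in i≤s)) h
          ... | tri≈ _ refl _ = ¬y h
          ... | tri> _ _ r<i = Y-out i≤s r<i (proj₁ (Reach-on j h))
          -- Being adjacent to the smaller ball but outside it, `w` is on the sphere, and stability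
          -- absorbs the step to it.
          closed-under : ∀ {t u w} → Reach j u → u ~ w → Ball r′ t → t ~ w → ¬ Ball r′ w → Reach j w
          closed-under {t} {u} ru u~w bt t~w ¬bw = stable (inj₂ (u , ru , u~w , inj₂ (t , bt , t~w) , ¬bw))
          cycle-in-reach : ∀ c → (∀ a → c a a ≡ false) → (∀ a b → c a b ≡ c b a) → (∀ a → sum (c a) ≡ false) →
            (∀ a b → c a b ≡ true → a ~ b × Reach j a × Reach j b) → Bounds c
          cycle-in-reach c irr symm closed inside = cycle-in-ball c irr symm closed λ a b h →
            let (a~b , ra , rb) = inside a b h in a~b , proj₁ (Reach-on j ra) , proj₁ (Reach-on j rb)
          open Separation (Ball? r′) (Reach? j) closed-under cycle-in-reach
          along : ∀ (f : ℕ → Fin n) a d → (∀ {i} → a ≤ i → i < a + d → colour (f i) ≡ colour (f (suc i))) →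
            colour (f a) ≡ colour (f (a + d))
          along f a zero step = cong (colour ∘ f) (sym (+-identityʳ a))
          along f a (suc d) step = trans (along f a d λ a≤i i< → step a≤i (<-≤-trans i< (+-monoʳ-≤ a (n≤1+n d))))
            (trans (step (m≤m+n a d) (≤-reflexive (sym (+-suc a d)))) (cong (colour ∘ f) (sym (+-suc a d))))
          linked : ∀ {u v ℓ} → Walk u v ℓ → ℓ ≤ 1 → ¬ Reach j u → ¬ Reach j v → colour u ≡ colour v
          linked [] _ _ _ = refl
          linked (α ∷ []) _ ¬u ¬v = colour-~ ¬u ¬v α
          linked (_ ∷ _ ∷ _) (s≤s ()) _ _

      -- A step without a new vertex would put `y` in `Reach j` by `stable⇒y`, too early for
      -- `arc-length`.
      grow : ∀ j → j ≤ r + r + η → ∃[ us ] (Unique us × length us ≡ suc j × All (Reach j) us)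
      grow zero _ = x ∷ [] , [] ∷ [] , refl , refl ∷ []
      grow (suc j) j< with grow j (<⇒≤ j<) | any? (λ u → Reach? (suc j) u ×-dec ¬? (Reach? j u))
      ... | us , uniq , len , all | yes (u , h , ¬h) =
        u ∷ us , All.map (λ { hv refl → ¬h hv }) all ∷ uniq , cong suc len , h ∷ All.map inj₁ all
      ... | _ | no ¬new = contradiction
        (arc-length j (stable⇒y j λ {u} h → decidable-stable (Reach? j u) λ ¬h → ¬new (u , h , ¬h))) (<⇒≱ j<)

      sphere-vertices : ∃[ us ] (Unique us × length us ≡ suc (r + r + η) × All OnSphere us)
      sphere-vertices = let (us , uniq , len , all) = grow (r + r + η) ≤-refl in
        us , uniq , len , All.map (Reach-on (r + r + η)) all

    -- The link has 1 + η vertices and the sphere of radius i at least 2i + 1 + η; spheres are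
    -- disjoint from smaller balls, and the sum up to r is (r + 1)² + η(r + 1).
    ball-vertices : ∀ r → r < s → ∃[ us ] (Unique us × length us ≡ suc r * suc r + η * suc r × All (Ball r) us)
    ball-vertices zero _ = start link η≤1 refl refl
      where
      start : ∀ {u v ℓ} → Walk u v ℓ → ℓ ≤ 1 → u ≡ p → v ≡ q →
        ∃[ us ] (Unique us × length us ≡ 1 + ℓ * 1 × All (Ball zero) us)
      start {u} [] _ u≡p _ = u ∷ [] , [] ∷ [] , refl , inj₁ u≡p ∷ []
      start {u} {v} ((u≢v , _) ∷ []) _ u≡p v≡q =
        u ∷ v ∷ [] , (u≢v ∷ []) ∷ [] ∷ [] , refl , inj₁ u≡p ∷ inj₂ v≡q ∷ []
      start (_ ∷ _ ∷ _) (s≤s ()) _ _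
    ball-vertices (suc r) r<s =
      let (us , uniq , len , all) = Sphere.sphere-vertices r r<s
          (vs , uniq′ , len′ , all′) = ball-vertices r (<⇒≤ r<s)
      in us ++ vs ,
        Unique.++⁺ uniq uniq′ (λ (∈us , ∈vs) → proj₂ (All.lookup all ∈us) (All.lookup all′ ∈vs)) ,
        trans (length-++ us) (trans (cong₂ _+_ len len′)
          (solve 2 (λ r η → con 1 ⊕ ((con 1 ⊕ r) ⊕ (con 1 ⊕ r) ⊕ η) ⊕ ((con 1 ⊕ r) ⊗ (con 1 ⊕ r) ⊕ η ⊗ (con 1 ⊕ r)) ⊜
            (con 2 ⊕ r) ⊗ (con 2 ⊕ r) ⊕ η ⊗ (con 2 ⊕ r)) refl r η)) ,
        All.++⁺ (All.map proj₁ all) (All.map inj₁ all′)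
      where open +-*-Solver using (solve; con) renaming (_:+_ to _⊕_; _:*_ to _⊗_; _:=_ to _⊜_)

    vertex-bound : ∀ {s′} → s ≡ suc s′ → suc (s * s + η * s) ≤ n
    vertex-bound {s′} eq = let (us , uniq , len , all) = ball-vertices s′ (≤-reflexive (sym eq)) in
      subst (λ ℓ → suc ℓ ≤ n) (trans len (cong (λ t → t * t + η * t) (sym eq)))
        -- The vertex put in front is the far end `at X s`, which lies outside the ball of radius
        -- `s′`.
        (unique-length (All.map (λ { b refl → X-out ≤-refl (≤-reflexive (sym eq)) b }) all ∷ uniq))

    -- Here (η + 2s)² = η² + 4(s² + ηs), and the far end counted in `vertex-bound` pays for η² ≤ 4.
    length-bound : 1 ≤ s → (η + (s + s)) * (η + (s + s)) ≤ 4 * n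
    length-bound 1≤s = ≤-trans
      (≤-reflexive (solve 2 (λ η s → (η ⊕ (s ⊕ s)) ⊗ (η ⊕ (s ⊕ s)) ⊜ η ⊗ η ⊕ con 4 ⊗ (s ⊗ s ⊕ η ⊗ s)) refl η s))
      (≤-trans (+-monoˡ-≤ (4 * (s * s + η * s)) η*η≤4)
        (≤-trans (≤-reflexive (sym (*-suc 4 (s * s + η * s))))
          (*-monoʳ-≤ 4 (vertex-bound (sym (m+[n∸m]≡n 1≤s))))))
      where
      open +-*-Solver using (solve; con) renaming (_:+_ to _⊕_; _:*_ to _⊗_; _:=_ to _⊜_)
      η*η≤4 : η * η ≤ 4
      η*η≤4 = ≤-trans (*-mono-≤ η≤1 η≤1) (s≤s z≤n)

  -- A shortest non-bounding closed walk as a cycle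

  Nonbounding : ℕ → Set
  Nonbounding ℓ = ∃[ u ] Σ (Walk u u ℓ) λ ω → ¬ Bounds (χ ω)

  Nonbounding? : Decidable Nonbounding
  Nonbounding? ℓ = any? λ u → search ℓ u u λ c → ¬? (bounds? c)

  shortest : ∀ ℓ → Nonbounding ℓ → ∃[ k ] (Nonbounding k × ∀ {j} → j < k → ¬ Nonbounding j)
  shortest = <-rec _ λ ℓ rec h → descend ℓ rec h (anyUpTo? Nonbounding? ℓ)
    where
    Goal : Set
    Goal = ∃[ k ] (Nonbounding k × ∀ {j} → j < k → ¬ Nonbounding j)
    descend : ∀ ℓ → (∀ {j} → j < ℓ → Nonbounding j → Goal) → Nonbounding ℓ →
      Dec (∃[ j ] (j < ℓ × Nonbounding j)) → Goal
    descend ℓ rec h (yes (j , j<ℓ , h′)) = rec j<ℓ h′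
    descend ℓ rec h (no ¬shorter) = ℓ , h , λ {j} j<ℓ h′ → ¬shorter (j , j<ℓ , h′)

  -- There are no loops, and a closed walk with two steps uses one edge twice.
  nonbounding-length : ∀ {u k} (ω : Walk u u k) → ¬ Bounds (χ ω) → 3 ≤ k
  nonbounding-length [] ¬bounds = contradiction Bounds-0 ¬bounds
  nonbounding-length ((u≢u , _) ∷ []) _ = contradiction refl u≢u
  nonbounding-length (_∷_ {u} {v} _ (_ ∷ [])) ¬bounds = contradiction
    (Bounds-≐ (λ a b → trans (cong (edge u v a b xor_) (trans (Bool.xor-identityʳ _) (edge-sym v u a b)))
      (Bool.xor-same (edge u v a b))) Bounds-0) ¬bounds
  nonbounding-length (_ ∷ _ ∷ _ ∷ _) _ = s≤s (s≤s (s≤s z≤n))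

  split : ∀ k {ℓ u w} (ω : Walk u w (k + ℓ)) →
    ∃[ v ] Σ (Walk u v k) λ α → Σ (Walk v w ℓ) λ β → χ ω ≐ (χ α ⊞ χ β)
  split zero ω = _ , [] , ω , λ _ _ → refl
  split (suc k) (_∷_ {u} {v} u~v ω) = let (x , α , β , eq) = split k ω in
    x , u~v ∷ α , β , λ a b → trans (cong (edge u v a b xor_) (eq a b)) (sym (Bool.xor-assoc (edge u v a b) _ _))

  halve : ∀ k → ∃[ η ] ∃[ s ] (η ≤ 1 × k ≡ η + (s + s))
  halve zero = 0 , 0 , z≤n , refl
  halve (suc k) with halve k
  ... | zero , s , _ , eq = 1 , s , ≤-refl , cong suc eq
  ... | suc zero , s , _ , eq = 0 , suc s , z≤n , trans (cong suc eq) (cong suc (sym (+-suc s s)))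
  ... | suc (suc _) , _ , s≤s () , _

  module Shortest {u : Fin n} {k : ℕ} (ω : Walk u u k) (¬bounds : ¬ Bounds (χ ω))
    (minimal : ∀ {j} → j < k → ¬ Nonbounding j) where

    short : ∀ {v ℓ} → ℓ < k → (α : Walk v v ℓ) → Bounds (χ α)
    short ℓ<k α = decidable-stable (bounds? (χ α)) λ h → minimal ℓ<k (_ , α , h)

    -- A repeated vertex would cut `ω` into two shorter closed walks; both would bound by
    -- minimality, and hence so would `ω`.
    at-distinct : ∀ {i j} → i < j → j < k → at ω i ≢ at ω j
    at-distinct {i} {j} i<j j<k eq = ¬bounds (Bounds-⊞
        (outer (take ω i≤k) (drop ω′ d) (trans eq (sym at-ω′)) outer<)
        (inner (take ω′ d≤) (trans at-ω′ (sym eq)) (≤-<-trans (m∸n≤m j i) j<k))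
        λ a b → trans (χ-split ω i≤k a b) (trans (cong (χ (take ω i≤k) a b xor_) (χ-split ω′ d≤ a b))
          (xor-solve 3 (λ x y z → x :+ (y :+ z) := (x :+ z) :+ y) refl
            (χ (take ω i≤k) a b) (χ (take ω′ d≤) a b) (χ (drop ω′ d) a b))))
      where
      i≤k : i ≤ k
      i≤k = <⇒≤ (<-trans i<j j<k)
      d : ℕ
      d = j ∸ i
      ω′ : Walk (at ω i) u (k ∸ i)
      ω′ = drop ω i
      d≤ : d ≤ k ∸ i
      d≤ = ∸-monoˡ-≤ i (<⇒≤ j<k)
      i+d≡j : i + d ≡ j
      i+d≡j = m+[n∸m]≡n (<⇒≤ i<j)
      at-ω′ : at ω′ d ≡ at ω j
      at-ω′ = trans (at-drop ω i d) (cong (at ω) i+d≡j)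
      outer< : i + (k ∸ i ∸ d) < k
      outer< = subst (λ t → i + t < k) (sym (trans (∸-+-assoc k i d) (cong (k ∸_) i+d≡j)))
        (<-≤-trans (+-monoˡ-< (k ∸ j) i<j) (≤-reflexive (m+[n∸m]≡n (<⇒≤ j<k))))
      inner : ∀ {v w ℓ} (α : Walk v w ℓ) → w ≡ v → ℓ < k → Bounds (χ α)
      inner α refl ℓ<k = short ℓ<k α
      outer : ∀ {v w a b} (α : Walk u v a) (β : Walk w u b) → v ≡ w → a + b < k → Bounds (χ α ⊞ χ β)
      outer α β refl h = Bounds-≐ (λ a b → sym (χ-++ α β a b)) (short h (α ++ʷ β))

    -- Positions 1 to `k ∸ 1`; the base point, at positions 0 and `k`, is kept apart as in
    -- `IsCycle`.
    vertices : List (Fin n)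
    vertices = applyUpTo (at ω ∘ suc) (k ∸ 1)

    3≤k : 3 ≤ k
    3≤k = nonbounding-length ω ¬bounds

    suc-k∸1 : suc (k ∸ 1) ≡ k
    suc-k∸1 = m+[n∸m]≡n (≤-trans (s≤s z≤n) 3≤k)

    cycle-list : u ∷ vertices ++ u ∷ [] ≡ applyUpTo (at ω) (suc k)
    cycle-list = trans
      (cong (applyUpTo (at ω) (suc (k ∸ 1)) ++_) (cong (_∷ []) (sym (trans (cong (at ω) suc-k∸1) (at-end ω)))))
      (trans (applyUpTo-∷ʳ (at ω) (suc (k ∸ 1))) (cong (applyUpTo (at ω) ∘ suc) suc-k∸1))

    length-vertices : length (u ∷ vertices) ≡ k
    length-vertices = trans (length-applyUpTo (at ω) (suc (k ∸ 1))) suc-k∸1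

    is-cycle : IsCycle face u vertices
    is-cycle =
      Unique.applyUpTo⁺₁ (at ω) (suc (k ∸ 1)) (λ i<j j<k → at-distinct i<j (subst (_ <_) suc-k∸1 j<k)) ,
      subst (3 ≤_) (sym length-vertices) 3≤k ,
      subst (Linked _~_) (sym cycle-list) (Linked.applyUpTo⁺₁ (at ω) (suc k) λ { (s≤s i<k) → at-~ ω i<k })

    noncontractible : ¬ ContractibleClosedWalk face u (u ∷ vertices ++ u ∷ [])
    noncontractible h = ¬bounds (Bounds-≐ (λ a b → sym (χᴸ-walk ω a b))
      (subst (Bounds ∘ χᴸ) cycle-list (contractible⇒bounds h)))

  shortest-length : ∀ {u} k (ω : Walk u u k) → ¬ Bounds (χ ω) → (∀ {j} → j < k → ¬ Nonbounding j) → k * k ≤ 4 * n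
  shortest-length k ω ¬bounds minimal with halve k
  ... | η , s , η≤1 , refl =
    let (q , link , rest , eq₁) = split η ω
        (z , X , Y , eq₂) = split s rest
    -- The base point is `p`; the last part is reversed so that both arms end at `z`.
    in Systole.length-bound η≤1 (Shortest.short ω ¬bounds minimal) link X (rev Y)
      (λ h → ¬bounds (Bounds-≐ (λ a b → trans (eq₁ a b) (trans (cong (χ link a b xor_) (eq₂ a b))
        (trans (sym (Bool.xor-assoc (χ link a b) _ _))
          (cong ((χ link a b xor χ X a b) xor_) (sym (χ-rev Y a b)))))) h))
      (positive η≤1 (nonbounding-length ω ¬bounds))
    where
    positive : ∀ {η s} → η ≤ 1 → 3 ≤ η + (s + s) → 1 ≤ s
    positive {s = suc _} _ _ = s≤s z≤n
    positive {zero} {zero} _ ()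
    positive {suc zero} {zero} _ (s≤s ())
    positive {suc (suc _)} {zero} (s≤s ()) _

theorem5 : ∀ (n : ℕ) (T : Triangulation n) → NonOrientable T →
    ∃[ k ] (HasNonContractibleCycleOfLength T k × k * k ≤ 4 * n)
-- Without vertices every orientation is vacuously coherent; otherwise `zero` serves as the base
-- point.
theorem5 zero T ¬orientable = contradiction ((λ _ → true) , λ _ _ ()) ¬orientable
theorem5 (suc n) T ¬orientable =
  let open Surface T
      (ℓ , h) = nonbounding-walk zero ¬orientable
      (k , (u , ω , ¬bounds) , minimal) = shortest ℓ h
      open Shortest ω ¬bounds minimal
  in k , (u , vertices , is-cycle , length-vertices , noncontractible) , shortest-length k ω ¬bounds minimal
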